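{- The Feedback Arc Set problem (FAS) is (polynomial-time many-one) reducible to the Acyclic Hamiltonian Partition problem (AHP).
   Context: All graphs are finite directed graphs. A feedback arc set of a digraph $G=\langle V,E\rangle$ is a subset $E'\subseteq E$ containing at least one arc of every directed cycle of $G$. FAS: Instance: a directed graph $G=\langle V,E\rangle$ and a positive integer $K\le|V|$. Question: is there a feedback arc set of $G$ of size at most $K$? For a digraph $G=\langle V,E\rangle$ and $V_1\subseteq V$, $G[V_1]$ is the induced subgraph. A partition $\pi=\{V_1,\dots,V_k\}$ of $V$ is an $\mathcal{H}^k$-partition if each $G[V_i]$ has a directed Hamiltonian path. The quotient digraph $G/\pi$ has vertex set $\pi$ and an arc $\langle V_i,V_j\rangle$ ($i\ne j$) whenever some arc of $E$ goes from $V_i$ to $V_j$. An $\mathcal{H}^{(\ast)}$-partition is an $\mathcal{H}^k$-partition (for some $k$) whose quotient digraph $G/\pi$ is acyclic. AHP: Instance: a DAG $G=\langle V,E\rangle$ and a positive integer $K\le|V|$. Question: is there an $\mathcal{H}^{(\ast)}$-partition of $G$ of size at most $K$? -}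

module Defs where

open import Data.Bool using (Bool; true; false; T)
open import Data.Fin using (Fin; zero)
open import Data.List using (List; []; _∷_; _++_; [_]; length; map; concat; replicate; tabulate; zip)
open import Data.List.Membership.Propositional using (_∈_)
open import Data.List.Relation.Unary.All using (All)
open import Data.List.Relation.Unary.Any using (Any)
open import Data.List.Relation.Unary.Linked using (Linked)
open import Data.List.Relation.Unary.Unique.Propositional using (Unique)
open import Data.Maybe using (Maybe; just; nothing)
import Data.Maybe as Maybe
open import Data.Nat using (ℕ; suc; _+_; _*_; _^_; _≤_; _>_)
open import Data.Product using (Σ; ∃; ∃-syntax; ∃₂; _×_; _,_; proj₁; uncurry)
open import Data.Vec using (Vec)
import Data.Vec as Vec
open import Function.Bundles using (_↔_; _⇔_)
open import Function.Definitions using (StrictlySurjective)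
open import Relation.Binary.PropositionalEquality using (_≡_; _≢_)
open import Relation.Nullary using (¬_)

-- Finiteness is imposed in FinDigraph below; loops are allowed.
record Digraph : Set₁ where
  field
    Vertex : Set
    Arc    : Vertex → Vertex → Set

-- The arcs traversed by the closed walk v, v₁, …, vₘ, v.
closedWalkArcs : {A : Set} → A → List A → List (A × A)
closedWalkArcs v vs = zip (v ∷ vs) (vs ++ [ v ])

-- A loop is a directed cycle (rest = []).
record DirectedCycle (G : Digraph) : Set where
  open Digraph G
  field
    start    : Vertex
    rest     : List Vertex
    distinct : Unique (start ∷ rest)
    are-arcs : All (uncurry Arc) (closedWalkArcs start rest)

  arcs : List (Vertex × Vertex)
  arcs = closedWalkArcs start rest

Acyclic : Digraph → Set
Acyclic G = ¬ DirectedCycle G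

record HamiltonianPath (G : Digraph) : Set where
  open Digraph G
  field
    path     : List Vertex
    linked   : Linked Arc path
    distinct : Unique path
    spanning : ∀ v → v ∈ path

induced : (G : Digraph) → (Digraph.Vertex G → Set) → Digraph
induced G V₁ = record
  { Vertex = Σ (Digraph.Vertex G) V₁
  ; Arc    = λ u v → Digraph.Arc G (proj₁ u) (proj₁ v)
  }

record FeedbackArcSet (G : Digraph) : Set where
  open Digraph G
  field
    members  : List (Vertex × Vertex)
    distinct : Unique members
    are-arcs : All (uncurry Arc) members
    hits     : (C : DirectedCycle G) → Any (_∈ members) (DirectedCycle.arcs C)

  size : ℕ
  size = length members

-- A partition {V₁, …, Vₖ} is given by the map sending a vertex to the index of
-- its part; surjectivity says that the parts are nonempty.
record Partition (A : Set) (k : ℕ) : Set where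
  field
    part     : A → Fin k
    nonempty : StrictlySurjective _≡_ part

  Part : Fin k → A → Set
  Part i v = part v ≡ i

quotient : (G : Digraph) {k : ℕ} → Partition (Digraph.Vertex G) k → Digraph
quotient G {k} π = record
  { Vertex = Fin k
  ; Arc    = λ i j → i ≢ j × ∃₂ λ u v → Part i u × Part j v × Digraph.Arc G u v
  }
  where open Partition π

IsHPartition : (G : Digraph) {k : ℕ} → Partition (Digraph.Vertex G) k → Set
IsHPartition G π = ∀ i → HamiltonianPath (induced G (Partition.Part π i))

IsAcyclicHPartition : (G : Digraph) {k : ℕ} → Partition (Digraph.Vertex G) k → Set
IsAcyclicHPartition G π = IsHPartition G π × Acyclic (quotient G π)

record FinDigraph : Set where
  field
    order : ℕ
    adj   : Fin order → Fin order → Bool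

  digraph : Digraph
  digraph = record { Vertex = Fin order ; Arc = λ u v → T (adj u v) }

-- Tape alphabet: the blank, the two input/output symbols, and a further auxiliary
-- symbols.
data Symbol (a : ℕ) : Set where
  blank : Symbol a
  bit   : Bool → Symbol a
  aux   : Fin a → Symbol a

data Move : Set where
  left stay right : Move

-- A two-way infinite tape: the symbols to the left of the head (nearest first),
-- the scanned symbol, and the symbols to its right (nearest first). All cells not
-- listed are blank.
record Tape (a : ℕ) : Set where
  constructor tape
  field
    leftward  : List (Symbol a)
    scanned   : Symbol a
    rightward : List (Symbol a)

move : ∀ {a} → Move → Tape a → Tape a
move stay  t                    = t
move left  (tape []       s rs) = tape [] blank (s ∷ rs)
move left  (tape (l ∷ ls) s rs) = tape ls l (s ∷ rs)
move right (tape ls s [])       = tape (s ∷ ls) blank []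
move right (tape ls s (r ∷ rs)) = tape (s ∷ ls) r rs

writeMove : ∀ {a} → Tape a → Symbol a × Move → Tape a
writeMove (tape ls _ rs) (s , m) = move m (tape ls s rs)

blankTape : ∀ {a} → Tape a
blankTape = tape [] blank []

inputTape : ∀ {a} → List Bool → Tape a
inputTape []       = blankTape
inputTape (b ∷ bs) = tape [] (bit b) (map bit bs)

leadingBits : ∀ {a} → List (Symbol a) → List Bool
leadingBits (bit b ∷ ss) = b ∷ leadingBits ss
leadingBits _            = []

-- The output is the longest block of bits starting at the scanned cell.
outputWord : ∀ {a} → Tape a → List Bool
outputWord (tape _ s rs) = leadingBits (s ∷ rs)

record TuringMachine : Set₁ where
  field
    State        : Set
    stateCount   : ℕ
    state-finite : State ↔ Fin stateCount
    start        : State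
    auxSymbols   : ℕ
    workTapes    : ℕ

  Sym : Set
  Sym = Symbol auxSymbols

  tapeCount : ℕ
  tapeCount = suc workTapes

  field
    -- nothing means that the machine halts
    δ : State → Vec Sym tapeCount → Maybe (State × Vec (Sym × Move) tapeCount)

  record Config : Set where
    eta-equality
    constructor config
    field
      state : State
      tapes : Vec (Tape auxSymbols) tapeCount

  step : Config → Maybe Config
  step (config q ts) = Maybe.map
    (λ (q′ , as) → config q′ (Vec.zipWith writeMove ts as))
    (δ q (Vec.map Tape.scanned ts))

  -- c ⇓[ t ] c′ : started in c, the machine halts in c′ after exactly t steps.
  data _⇓[_]_ : Config → ℕ → Config → Set where
    halted : ∀ {c} → step c ≡ nothing → c ⇓[ 0 ] c
    steps  : ∀ {c c′ c″ t} → step c ≡ just c′ → c′ ⇓[ t ] c″ → c ⇓[ suc t ] c″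

  -- Tape zero holds the input at the start and the output at the end.
  initial : List Bool → Config
  initial w = config start (inputTape w Vec.∷ Vec.replicate workTapes blankTape)

  output : Config → List Bool
  output c = outputWord (Vec.lookup (Config.tapes c) zero)

  Outputs_On_InTime_ : List Bool → List Bool → ℕ → Set
  Outputs v On w InTime t = ∃[ c ] (initial w ⇓[ t ] c × output c ≡ v)

record Problem : Set₁ where
  field
    Instance : Set
    encode   : Instance → List Bool
    Yes      : Instance → Set

-- Running time at most c · |w|ᵈ + c on an encoding w, for some constants c and d.
PolyTimeComputable : (P Q : Problem) → (Problem.Instance P → Problem.Instance Q) → Set₁
PolyTimeComputable P Q f =
  Σ TuringMachine λ M → ∃₂ λ c d → ∀ x → ∃[ t ]
    (TuringMachine.Outputs_On_InTime_ M (Problem.encode Q (f x)) (Problem.encode P x) t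
     × t ≤ c * length (Problem.encode P x) ^ d + c)

_ReducesTo_ : Problem → Problem → Set₁
P ReducesTo Q =
  Σ (Problem.Instance P → Problem.Instance Q) λ f →
    PolyTimeComputable P Q f × (∀ x → Problem.Yes P x ⇔ Problem.Yes Q (f x))

unary : ℕ → List Bool
unary n = replicate n true ++ [ false ]

-- 1ⁿ 0 1ᴷ 0 followed by the n² entries of the adjacency matrix, row by row.
-- Since K ≤ n, writing K in unary does not inflate the length of an instance.
encodeGraphWithBound : FinDigraph → ℕ → List Bool
encodeGraphWithBound G K =
  unary order ++ unary K ++ concat (tabulate λ u → tabulate λ v → adj u v)
  where open FinDigraph G

record FASInstance : Set where
  field
    graph    : FinDigraph
    K        : ℕ
    positive : K > 0
    bounded  : K ≤ FinDigraph.order graph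

record AHPInstance : Set where
  field
    graph    : FinDigraph
    acyclic  : Acyclic (FinDigraph.digraph graph)
    K        : ℕ
    positive : K > 0
    bounded  : K ≤ FinDigraph.order graph

FAS : Problem
FAS = record
  { Instance = FASInstance
  ; encode   = λ x → encodeGraphWithBound (FASInstance.graph x) (FASInstance.K x)
  ; Yes      = λ x → Σ (FeedbackArcSet (FinDigraph.digraph (FASInstance.graph x)))
                       λ F → FeedbackArcSet.size F ≤ FASInstance.K x
  }

AHP : Problem
AHP = record
  { Instance = AHPInstance
  ; encode   = λ x → encodeGraphWithBound (AHPInstance.graph x) (AHPInstance.K x)
  ; Yes      = λ x → let G = FinDigraph.digraph (AHPInstance.graph x) in
                     ∃[ k ] (k ≤ AHPInstance.K x ×
                       Σ (Partition (Digraph.Vertex G) k) (IsAcyclicHPartition G))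
  }

{-# OPTIONS --safe #-}

-- Given G on n vertices, every vertex v becomes a path pre v → hub v → post v and every
-- pair e = (u , v) becomes an arc exit e → entry e, together with hub u → entry e and, if
-- e is an arc of G, exit e → hub v. The result is a DAG with three levels. In the
-- partition into these n + n² paths the quotient contains G with its arcs subdivided, and
-- separating exit e from entry e removes e at the cost of one more part. Conversely, in
-- an acyclic Hamiltonian partition the pairs e for which {exit e , entry e} is not a part
-- form a feedback arc set. Each of them costs a part: a hub that absorbs exit e leaves its
-- pre node alone (and likewise for entry e and post), which yields an injection of
-- vertices, pairs and cut pairs into the parts.
--
-- The adjacency matrix of this DAG consists of constant, one-hot and input words, so it
-- is written by a while program on seven tapes that copies words. If every loop makes at
-- most S iterations in each execution, the running time is polynomial in S, and S can be
-- taken to be the length of the output.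

module Submission where

open import Defs

open import Axiom.UniquenessOfIdentityProofs using (module Decidable⇒UIP)
open import Data.Bool using (Bool; true; false; T; _∧_; if_then_else_)
open import Data.Bool.Properties using (T-∧; T?)
open import Data.Fin using (Fin; zero; suc; toℕ; splitAt; combine; quotRem; remQuot)
open import Data.Fin.Properties using
  (_≟_; any?; all?; toℕ-injective; toℕ<n; toℕ-combine; +↔⊎; 1↔⊤; injective⇒≤;
   remQuot-combine; combine-remQuot)
open import Data.List as List using
  (List; []; _∷_; _++_; _ʳ++_; allFin; concat; filter; length; map; replicate; tabulate; zip)
open import Data.List.Membership.DecPropositional as DecMembership using ()
open import Data.List.Membership.Propositional using (_∈_; _∉_; find)
open import Data.List.Membership.Propositional.Properties using
  (∈-map⁺; ∈-map⁻; ∈-filter⁺; ∈-filter⁻; ∈-allFin; ∈-lookup)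
open import Data.List.Properties using
  (++-ʳ++; ʳ++-ʳ++; ++-identityʳ; concat-++; concat-concat; length-++; length-ʳ++; length-map;
   length-replicate; length-tabulate; map-tabulate; tabulate-cong)
open import Data.List.Relation.Unary.All as All using (All; []; _∷_)
open import Data.List.Relation.Unary.All.Properties using (¬Any⇒All¬)
open import Data.List.Relation.Unary.AllPairs using ([]; _∷_)
open import Data.List.Relation.Unary.Any as Any using (Any; here; there; index)
open import Data.List.Relation.Unary.Any.Properties using (lookup-index)
open import Data.List.Relation.Unary.Linked as Linked using (Linked; [-]; _∷_)
import Data.List.Relation.Unary.Linked.Properties as Linked
open import Data.List.Relation.Unary.Unique.Propositional using (Unique)
import Data.List.Relation.Unary.Unique.Propositional.Properties as Unique
open import Data.Maybe as Maybe using (Maybe; just; nothing; maybe)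
open import Data.Nat using (ℕ; zero; suc; _+_; _*_; _^_; _⊔_; _≡ᵇ_; _≤_; _<_; z≤n; s≤s; NonZero)
open import Data.Nat.Properties as ℕ using
  (≤-refl; ≤-trans; ≤-reflexive; <-trans; <-irrefl; +-mono-≤; ≡ᵇ⇒≡; ≡⇒≡ᵇ)
open import Data.Nat.Tactic.RingSolver using (solve-∀)
open import Data.Product as Product using
  (Σ; ∃-syntax; ∃₂; _×_; _,_; proj₁; proj₂; swap; uncurry)
open import Data.Product.Properties using (≡-dec)
open import Data.Sum as Sum using (_⊎_; inj₁; inj₂)
open import Data.Sum.Function.Propositional using (_⊎-↔_)
open import Data.Unit using (⊤; tt)
open import Data.Vec as Vec using (Vec; []; _∷_; lookup; _[_]≔_)
open import Data.Vec.Properties using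
  (lookup-map; lookup∘update; map-replicate; []≔-idempotent; []≔-lookup)
open import Function using (_∘_; id; const)
open import Function.Bundles using (_↔_; _⇔_; mk⇔; mk↔ₛ′; Inverse; Equivalence)
open import Function.Construct.Composition using (_↔-∘_)
open import Function.Construct.Identity using (↔-id)
open import Function.Construct.Symmetry using (↔-sym)
open import Relation.Binary.Construct.Closure.Transitive using
  (TransClosure; [_]; _∷_; _∷ʳ_) renaming (_++_ to _⁺++_)
open import Relation.Binary.Definitions using (DecidableEquality)
open import Relation.Binary.PropositionalEquality using
  (_≡_; _≢_; refl; sym; trans; cong; cong₂; subst; subst₂; module ≡-Reasoning)
open import Relation.Nullary using (¬_; Dec; yes; no; contradiction)
open import Relation.Nullary.Decidable using (_×-dec_; ¬?)

-- Cycles and partitions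

-- The nodes `pre v` and `post v` make cutting expensive: without them the parts {`exit e`, `hub v`}
-- and {`entry e`} would destroy the arc `e` and leave the number of parts unchanged. Arcs raise the
-- level, so a part holds at most one node of each level and a hub can absorb at most one exit and
-- one entry. Each absorption frees one part of its own.
--
-- Using all pairs instead of the arcs makes the nodes and the block layout of the matrix depend on
-- `n` alone. A pair that is not adjacent costs one part in either direction, and the part
-- {`exit e`, `entry e`} then has no arc out of it, so it cannot affect acyclicity. The bound is
-- therefore shifted by exactly n + n².
--
-- A directed cycle has distinct vertices, whereas subdividing arcs and contracting parts yields
-- closed walks that may repeat vertices. Both directions argue with transitive closures and extract
-- a cycle only at the end.

lookup-injective : {A : Set} {xs : List A} → Unique xs →
                   ∀ {i j} → List.lookup xs i ≡ List.lookup xs j → i ≡ j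
lookup-injective (x∉ ∷ u) {zero}  {zero}  eq = refl
lookup-injective {xs = _ ∷ xs} (x∉ ∷ u) {zero} {suc j} eq =
  contradiction eq (All.lookup x∉ (∈-lookup {xs = xs} j))
lookup-injective {xs = _ ∷ xs} (x∉ ∷ u) {suc i} {zero} eq =
  contradiction (sym eq) (All.lookup x∉ (∈-lookup {xs = xs} i))
lookup-injective (x∉ ∷ u) {suc i} {suc j} eq = cong suc (lookup-injective u eq)

module _ {A : Set} {R : A → A → Set} where

  -- Shaped so that the arcs of a directed cycle are by definition a walk from `start` through
  -- `rest` back to `start`.
  IsWalk : A → List A → A → Set
  IsWalk x xs y = All (uncurry R) (zip (x ∷ xs) (xs ++ y ∷ []))

  walk⇒⁺ : ∀ x xs {y} → IsWalk x xs y → TransClosure R x y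
  walk⇒⁺ x []        (r ∷ []) = [ r ]
  walk⇒⁺ x (x′ ∷ xs) (r ∷ rs) = r ∷ walk⇒⁺ x′ xs rs

  walk-suffix : ∀ {x y} z zs → Unique (z ∷ zs) → IsWalk z zs y → x ∈ z ∷ zs →
                ∃[ xs ] (Unique (x ∷ xs) × IsWalk x xs y)
  walk-suffix z zs        u       w       (here refl) = zs , u , w
  walk-suffix z (z′ ∷ zs) (_ ∷ u) (_ ∷ w) (there x∈)  = walk-suffix z′ zs u w x∈

  -- Loop erasure: if `x` reappears in the shortened remainder, the suffix from that occurrence
  -- replaces the walk. The end `y` is kept apart from the distinct vertices, so `x ≡ y` is allowed
  -- and gives a cycle, possibly a loop.
  simple-walk : DecidableEquality A → ∀ {x y} → TransClosure R x y →
                ∃[ xs ] (Unique (x ∷ xs) × IsWalk x xs y)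
  simple-walk _≟ᴬ_ [ r ] = [] , [] ∷ [] , r ∷ []
  simple-walk _≟ᴬ_ (_∷_ {x} {z} r w) with simple-walk _≟ᴬ_ w
  ... | zs , u , w′ with DecMembership._∈?_ _≟ᴬ_ x (z ∷ zs)
  ...   | yes x∈ = walk-suffix z zs u w′ x∈
  ...   | no  x∉ = z ∷ zs , ¬Any⇒All¬ _ x∉ ∷ u , r ∷ w′

  closed⇒cycle : DecidableEquality A → ∀ {x} → TransClosure R x x →
                 DirectedCycle (record { Vertex = A ; Arc = R })
  closed⇒cycle _≟ᴬ_ {x} w = let xs , u , w′ = simple-walk _≟ᴬ_ w in record
    { start = x ; rest = xs ; distinct = u ; are-arcs = w′ }

  -- Hamiltonicity of a part enters the converse only through this comparability of any two of its
  -- vertices.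
  linked-connex : ∀ {xs} → Linked R xs → ∀ {x y} → x ∈ xs → y ∈ xs →
                  x ≡ y ⊎ TransClosure R x y ⊎ TransClosure R y x
  linked-connex l (here refl) (here refl) = inj₁ refl
  linked-connex (r ∷ l) (here refl) (there y∈) = inj₂ (inj₁ (from-head r l y∈))
    where
    from-head : ∀ {x y z xs} → R x y → Linked R (y ∷ xs) → z ∈ y ∷ xs → TransClosure R x z
    from-head r l       (here refl) = [ r ]
    from-head r (s ∷ l) (there z∈)  = r ∷ from-head s l z∈
  linked-connex l@(_ ∷ _) (there x∈) (here refl) with linked-connex l (here refl) (there x∈)
  ... | inj₁ eq        = inj₁ (sym eq)
  ... | inj₂ (inj₁ w)  = inj₂ (inj₂ w)
  ... | inj₂ (inj₂ w)  = inj₂ (inj₁ w)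
  linked-connex (_ ∷ l) (there x∈) (there y∈) = linked-connex l x∈ y∈

  ranked-⁺ : (rank : A → ℕ) → (∀ {x y} → R x y → rank x < rank y) →
             ∀ {x y} → TransClosure R x y → rank x < rank y
  ranked-⁺ rank rank-< [ r ]   = rank-< r
  ranked-⁺ rank rank-< (r ∷ w) = <-trans (rank-< r) (ranked-⁺ rank rank-< w)

map-⁺ : {A B : Set} {R : A → A → Set} {S : B → B → Set} (f : A → B) →
        (∀ {x y} → R x y → S (f x) (f y)) →
        ∀ {x y} → TransClosure R x y → TransClosure S (f x) (f y)
map-⁺ f g [ r ]   = [ g r ]
map-⁺ f g (r ∷ w) = g r ∷ map-⁺ f g w

Σ-fibre-≡ : {A : Set} {k : ℕ} {h : A → Fin k} {i : Fin k} {x y : Σ A (λ a → h a ≡ i)} →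
            proj₁ x ≡ proj₁ y → x ≡ y
Σ-fibre-≡ {x = a , p} {y = _ , q} refl = cong (a ,_) (Decidable⇒UIP.≡-irrelevant _≟_ p q)

AcyclicHPartition : Digraph → ℕ → Set
AcyclicHPartition G k = Σ (Partition (Digraph.Vertex G) k) (IsAcyclicHPartition G)

module _ {G H : Digraph}
         (f : Digraph.Vertex G → Digraph.Vertex H) (g : Digraph.Vertex H → Digraph.Vertex G)
         (g∘f : ∀ x → g (f x) ≡ x) (f∘g : ∀ y → f (g y) ≡ y)
         (f-arc : ∀ {x y} → Digraph.Arc G x y → Digraph.Arc H (f x) (f y))
         (g-arc : ∀ {x y} → Digraph.Arc H x y → Digraph.Arc G (g x) (g y)) where

  -- Paths are carried along `f`. The indices of the parts do not change, so a cycle of the new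
  -- quotient is a cycle of the old one on the same indices; `g` only moves the end points that
  -- witness its arcs.
  transport-partition : ∀ {k} → AcyclicHPartition G k → AcyclicHPartition H k
  transport-partition (π , hamiltonian , acyclic) = π′ , hamiltonian′ , acyclic′
    where
    open Partition π
    open HamiltonianPath

    π′ = record
      { part     = part ∘ g
      ; nonempty = λ i → let x , x∈i = nonempty i in f x , trans (cong part (g∘f x)) x∈i
      }

    to : ∀ {i} → Σ _ (Part i) → Σ _ (Partition.Part π′ i)
    to (x , x∈i) = f x , trans (cong part (g∘f x)) x∈i

    to-injective : ∀ {i} {x y : Σ _ (Part i)} → to x ≡ to y → x ≡ y
    to-injective {x = x , _} {y , _} eq =
      Σ-fibre-≡ (trans (sym (g∘f x)) (trans (cong (g ∘ proj₁) eq) (g∘f y)))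

    hamiltonian′ : IsHPartition H π′
    hamiltonian′ i = record
      { path     = map to (path (hamiltonian i))
      ; linked   = Linked.map⁺ (Linked.map f-arc (linked (hamiltonian i)))
      ; distinct = Unique.map⁺ to-injective (distinct (hamiltonian i))
      ; spanning = λ (y , y∈i) → subst (_∈ _) (Σ-fibre-≡ (f∘g y))
                     (∈-map⁺ to (spanning (hamiltonian i) (g y , y∈i)))
      }

    acyclic′ : Acyclic (quotient H π′)
    acyclic′ C = acyclic record
      { start    = C.start
      ; rest     = C.rest
      ; distinct = C.distinct
      ; are-arcs = All.map (λ (i≢j , u , v , u∈i , v∈j , a) →
                              i≢j , g u , g v , u∈i , v∈j , g-arc a) C.are-arcs
      }
      where module C = DirectedCycle C

-- The gadget graph

-- Comparing through `toℕ` and `≡ᵇ` makes the nonconstant blocks of the rows of `pre v` and `hub v`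
-- definitionally built from `oneHot` words, which the tape program can copy.
_==_ : ∀ {n} → Fin n → Fin n → Bool
i == j = toℕ i ≡ᵇ toℕ j

==⇒≡ : ∀ {n} {i j : Fin n} → T (i == j) → i ≡ j
==⇒≡ = toℕ-injective ∘ ≡ᵇ⇒≡ _ _

==-refl : ∀ {n} (i : Fin n) → T (i == i)
==-refl i = ≡⇒≡ᵇ (toℕ i) (toℕ i) refl

module Reduction (n : ℕ) (adj : Fin n → Fin n → Bool) where

  -- Every pair of vertices is treated as a potential arc; only the pairs adjacent
  -- in G can be left towards a hub.
  Pair : Set
  Pair = Fin (n * n)

  ends : Pair → Fin n × Fin n
  ends = remQuot {n} n

  tail head : Pair → Fin n
  tail = proj₁ ∘ ends
  head = proj₂ ∘ ends

  pair : Fin n × Fin n → Pair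
  pair = uncurry combine

  ends-pair : ∀ p → ends (pair p) ≡ p
  ends-pair (u , v) = remQuot-combine u v

  ends-injective : ∀ {e e′} → ends e ≡ ends e′ → e ≡ e′
  ends-injective {e} {e′} eq =
    trans (sym (combine-remQuot {n} n e)) (trans (cong pair eq) (combine-remQuot {n} n e′))

  data Node : Set where
    pre hub post : Fin n → Node
    exit entry   : Pair → Node

  -- The summands are listed in the order in which the program writes rows and columns: pre, exit,
  -- hub, post, entry.
  order : ℕ
  order = n + (n * n + (n + (n + n * n)))

  Kind : Set
  Kind = Fin n ⊎ (Pair ⊎ (Fin n ⊎ (Fin n ⊎ Pair)))

  fromKind : Kind → Node
  fromKind (inj₁ v)                      = pre v
  fromKind (inj₂ (inj₁ e))               = exit e
  fromKind (inj₂ (inj₂ (inj₁ v)))        = hub v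
  fromKind (inj₂ (inj₂ (inj₂ (inj₁ v)))) = post v
  fromKind (inj₂ (inj₂ (inj₂ (inj₂ e)))) = entry e

  numbering : Fin order ↔ Node
  numbering = mk↔ₛ′ fromKind from to∘from from∘to ↔-∘
    ((↔-id _ ⊎-↔ ((↔-id _ ⊎-↔ ((↔-id _ ⊎-↔ +↔⊎) ↔-∘ +↔⊎)) ↔-∘ +↔⊎)) ↔-∘ +↔⊎)
    where
    from : Node → Kind
    from (pre v)   = inj₁ v
    from (exit e)  = inj₂ (inj₁ e)
    from (hub v)   = inj₂ (inj₂ (inj₁ v))
    from (post v)  = inj₂ (inj₂ (inj₂ (inj₁ v)))
    from (entry e) = inj₂ (inj₂ (inj₂ (inj₂ e)))
    to∘from : ∀ x → fromKind (from x) ≡ x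
    to∘from (pre _)   = refl
    to∘from (exit _)  = refl
    to∘from (hub _)   = refl
    to∘from (post _)  = refl
    to∘from (entry _) = refl
    from∘to : ∀ k → from (fromKind k) ≡ k
    from∘to (inj₁ _)                      = refl
    from∘to (inj₂ (inj₁ _))               = refl
    from∘to (inj₂ (inj₂ (inj₁ _)))        = refl
    from∘to (inj₂ (inj₂ (inj₂ (inj₁ _)))) = refl
    from∘to (inj₂ (inj₂ (inj₂ (inj₂ _)))) = refl

  arc : Node → Node → Bool
  arc (pre v)  (hub w)    = v == w
  arc (exit e) (hub w)    = (head e == w) ∧ adj (tail e) (head e)
  arc (exit e) (entry e′) = e == e′
  arc (hub v)  (post w)   = v == w
  arc (hub v)  (entry e)  = v == tail e
  arc _        _          = false

  infix 4 _⟶_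

  data _⟶_ : Node → Node → Set where
    pre⟶hub    : ∀ v → pre v ⟶ hub v
    hub⟶post   : ∀ v → hub v ⟶ post v
    hub⟶entry  : ∀ e → hub (tail e) ⟶ entry e
    exit⟶entry : ∀ e → exit e ⟶ entry e
    exit⟶hub   : ∀ e → T (adj (tail e) (head e)) → exit e ⟶ hub (head e)

  arc⇒⟶ : ∀ x y → T (arc x y) → x ⟶ y
  arc⇒⟶ (pre v)  (hub w)    a with refl ← ==⇒≡ {i = v} {w} a = pre⟶hub v
  arc⇒⟶ (hub v)  (post w)   a with refl ← ==⇒≡ {i = v} {w} a = hub⟶post v
  arc⇒⟶ (hub v)  (entry e)  a with refl ← ==⇒≡ {i = v} {tail e} a = hub⟶entry e
  arc⇒⟶ (exit e) (entry e′) a with refl ← ==⇒≡ {i = e} {e′} a = exit⟶entry e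
  arc⇒⟶ (exit e) (hub w)    a with Equivalence.to (T-∧ {head e == w}) a
  ... | h , b with refl ← ==⇒≡ {i = head e} {w} h = exit⟶hub e b

  ⟶⇒arc : ∀ {x y} → x ⟶ y → T (arc x y)
  ⟶⇒arc (pre⟶hub v)    = ==-refl v
  ⟶⇒arc (hub⟶post v)   = ==-refl v
  ⟶⇒arc (hub⟶entry e)  = ==-refl (tail e)
  ⟶⇒arc (exit⟶entry e) = ==-refl e
  ⟶⇒arc (exit⟶hub e a) = Equivalence.from (T-∧ {head e == head e}) (==-refl (head e) , a)

  G Gadget : Digraph
  G      = record { Vertex = Fin n ; Arc = λ u v → T (adj u v) }
  Gadget = record { Vertex = Node  ; Arc = _⟶_ }

  level : Node → ℕ
  level (pre _)   = 0
  level (exit _)  = 0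
  level (hub _)   = 1
  level (post _)  = 2
  level (entry _) = 2

  level-< : ∀ {x y} → x ⟶ y → level x < level y
  level-< (pre⟶hub _)    = s≤s z≤n
  level-< (hub⟶post _)   = s≤s (s≤s z≤n)
  level-< (hub⟶entry _)  = s≤s (s≤s z≤n)
  level-< (exit⟶entry _) = s≤s z≤n
  level-< (exit⟶hub _ _) = s≤s z≤n

  -- Serves both directions: with `s` the size of a feedback arc set it numbers the parts, and with
  -- `s` the number of cuts it counts the slots that are injected into the parts.
  part-index : ∀ s → Fin (n + (n * n + s)) ↔ (Fin n ⊎ (Pair ⊎ Fin s))
  part-index s = (↔-id _ ⊎-↔ +↔⊎) ↔-∘ +↔⊎

  -- From a feedback arc set to an acyclic Hamiltonian partition

  module FromFAS (F : FeedbackArcSet G) where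
    open FeedbackArcSet F
    open DecMembership (≡-dec (_≟_ {n}) (_≟_ {n})) using (_∈?_)

    Class : Set
    Class = Fin n ⊎ (Pair ⊎ Fin size)

    parts : ℕ
    parts = n + (n * n + size)

    open Inverse (part-index size) using (to; from; strictlyInverseˡ; strictlyInverseʳ)

    from-injective : ∀ {c d} → from c ≡ from d → c ≡ d
    from-injective {c} {d} eq =
      trans (sym (strictlyInverseˡ c)) (trans (cong to eq) (strictlyInverseˡ d))

    entry-class : ∀ e → Dec (ends e ∈ members) → Class
    entry-class e (yes p) = inj₂ (inj₂ (index p))
    entry-class e (no _)  = inj₂ (inj₁ e)

    class : Node → Class
    class (pre v)   = inj₁ v
    class (hub v)   = inj₁ v
    class (post v)  = inj₁ v
    class (exit e)  = inj₂ (inj₁ e)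
    class (entry e) = entry-class e (ends e ∈? members)

    member : Fin size → Pair
    member i = pair (List.lookup members i)

    -- The membership test returns some position of the pair in `members`; as the members are
    -- distinct, that position is `i`.
    class-entry-member : ∀ i → class (entry (member i)) ≡ inj₂ (inj₂ i)
    class-entry-member i with ends (member i) ∈? members
    ... | yes p = cong (inj₂ ∘ inj₂) (lookup-injective distinct
                    (trans (sym (lookup-index p)) (ends-pair (List.lookup members i))))
    ... | no ¬p = contradiction (subst (_∈ members) (sym (ends-pair _)) (∈-lookup i)) ¬p

    -- An exit stays in the class of its pair whether or not its entry is separated, so no class
    -- becomes empty.
    representative : Class → Node
    representative (inj₁ v)        = hub v
    representative (inj₂ (inj₁ e)) = exit e
    representative (inj₂ (inj₂ i)) = entry (member i)

    class-representative : ∀ c → class (representative c) ≡ c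
    class-representative (inj₁ v)        = refl
    class-representative (inj₂ (inj₁ e)) = refl
    class-representative (inj₂ (inj₂ i)) = class-entry-member i

    partition : Partition Node parts
    partition = record
      { part     = from ∘ class
      ; nonempty = λ i → representative (to i) ,
                     trans (cong from (class-representative (to i))) (strictlyInverseʳ i)
      }

    open Partition partition using (Part)

    entry-class≢hub : ∀ {e v} d → entry-class e d ≢ inj₁ v
    entry-class≢hub (yes _) ()
    entry-class≢hub (no _)  ()

    entry-class-exit : ∀ {e e′} d → entry-class e d ≡ inj₂ (inj₁ e′) → e ≡ e′ × ends e ∉ members
    entry-class-exit (no e∉) refl = refl , e∉

    entry-class-member : ∀ {e i} d → entry-class e d ≡ inj₂ (inj₂ i) → ends e ≡ List.lookup members i
    entry-class-member (yes p) refl = lookup-index p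

    class-entry-remaining : ∀ {e} → ends e ∉ members → class (entry e) ≡ inj₂ (inj₁ e)
    class-entry-remaining {e} e∉ with ends e ∈? members
    ... | yes e∈ = contradiction e∈ e∉
    ... | no _   = refl

    path-of : ∀ c → HamiltonianPath (induced Gadget (Part (from c)))
    path-of (inj₁ v) = record
      { path     = (pre v , refl) ∷ (hub v , refl) ∷ (post v , refl) ∷ []
      ; linked   = pre⟶hub v ∷ hub⟶post v ∷ [-]
      ; distinct = ((λ ()) ∷ (λ ()) ∷ []) ∷ ((λ ()) ∷ []) ∷ [] ∷ []
      ; spanning = λ (x , p) → spans x (from-injective p)
      }
      where
      spans : ∀ x {p} → class x ≡ inj₁ v → (x , p) ∈ _
      spans (pre _)   refl = here (Σ-fibre-≡ refl)
      spans (hub _)   refl = there (here (Σ-fibre-≡ refl))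
      spans (post _)  refl = there (there (here (Σ-fibre-≡ refl)))
      spans (entry e) eq   = contradiction eq (entry-class≢hub (ends e ∈? members))
    path-of (inj₂ (inj₁ e)) with ends e ∈? members
    ... | yes e∈ = record
      { path     = (exit e , refl) ∷ []
      ; linked   = [-]
      ; distinct = [] ∷ []
      ; spanning = λ (x , p) → spans x (from-injective p)
      }
      where
      spans : ∀ x {p} → class x ≡ inj₂ (inj₁ e) → (x , p) ∈ _
      spans (exit _)   refl = here (Σ-fibre-≡ refl)
      spans (entry e′) eq with refl , e∉ ← entry-class-exit (ends e′ ∈? members) eq =
        contradiction e∈ e∉
    ... | no e∉ = record
      { path     = (exit e , refl) ∷ (entry e , cong from (class-entry-remaining e∉)) ∷ []
      ; linked   = exit⟶entry e ∷ [-]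
      ; distinct = ((λ ()) ∷ []) ∷ [] ∷ []
      ; spanning = λ (x , p) → spans x (from-injective p)
      }
      where
      spans : ∀ x {p} → class x ≡ inj₂ (inj₁ e) → (x , p) ∈ _
      spans (exit _)   refl = here (Σ-fibre-≡ refl)
      spans (entry e′) eq   =
        there (here (Σ-fibre-≡ (cong entry (proj₁ (entry-class-exit (ends e′ ∈? members) eq)))))
    path-of (inj₂ (inj₂ i)) = record
      { path     = (entry (member i) , cong from (class-entry-member i)) ∷ []
      ; linked   = [-]
      ; distinct = [] ∷ []
      ; spanning = λ (x , p) → spans x (from-injective p)
      }
      where
      spans : ∀ x {p} → class x ≡ inj₂ (inj₂ i) → (x , p) ∈ _
      spans (entry e) eq = here (Σ-fibre-≡ (cong entry (ends-injective
        (trans (entry-class-member (ends e ∈? members) eq) (sym (ends-pair (List.lookup members i)))))))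

    hamiltonian : IsHPartition Gadget partition
    hamiltonian i =
      subst (λ j → HamiltonianPath (induced Gadget (Part j))) (strictlyInverseʳ i) (path-of (to i))

    -- Over-approximates the arcs of the quotient. The class of a separated entry has no step out of
    -- it, so `stuck` and `stuck′` may allow any source. `enter` keeps `ends e ∉ members`, because
    -- only then does `entry e` lie in the class of `exit e`.
    data Step : Class → Class → Set where
      enter : ∀ e → ends e ∉ members → Step (inj₁ (tail e)) (inj₂ (inj₁ e))
      leave : ∀ e → T (adj (tail e) (head e)) → Step (inj₂ (inj₁ e)) (inj₁ (head e))
      stuck : ∀ {v i} → Step (inj₁ v) (inj₂ (inj₂ i))
      stuck′ : ∀ {e i} → Step (inj₂ (inj₁ e)) (inj₂ (inj₂ i))

    arc⇒Step : ∀ {x y} → x ⟶ y → class x ≢ class y → Step (class x) (class y)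
    arc⇒Step (pre⟶hub v)    ≢ = contradiction refl ≢
    arc⇒Step (hub⟶post v)   ≢ = contradiction refl ≢
    arc⇒Step (exit⟶hub e a) ≢ = leave e a
    arc⇒Step (hub⟶entry e)  ≢ with ends e ∈? members
    ... | yes _  = stuck
    ... | no e∉  = enter e e∉
    arc⇒Step (exit⟶entry e) ≢ with ends e ∈? members
    ... | yes _  = stuck′
    ... | no _   = contradiction refl ≢

    Remaining : Fin n → Fin n → Set
    Remaining u v = T (adj u v) × (u , v) ∉ members

    -- Between hub classes the steps alternate: `enter e` can only be continued to a hub by
    -- `leave e` with the same `e`, and such a pair of steps is one surviving arc of `G`.
    vertex-walk : ∀ {u v} → TransClosure Step (inj₁ u) (inj₁ v) → TransClosure Remaining u v
    vertex-walk (enter e e∉ ∷ [ leave _ a ])        = [ a , e∉ ]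
    vertex-walk (enter e e∉ ∷ leave _ a ∷ w)        = (a , e∉) ∷ vertex-walk w
    vertex-walk (enter e e∉ ∷ stuck′ ∷ [ () ])
    vertex-walk (enter e e∉ ∷ stuck′ ∷ () ∷ _)
    vertex-walk (stuck ∷ [ () ])
    vertex-walk (stuck ∷ () ∷ _)

    remaining-acyclic : ∀ {v} → ¬ TransClosure Remaining v v
    remaining-acyclic w = avoids (proj₂ (find (hits cycle)))
      where
      C = closed⇒cycle _≟_ w
      module C = DirectedCycle C
      cycle : DirectedCycle G
      cycle = record { start = C.start ; rest = C.rest ; distinct = C.distinct
                     ; are-arcs = All.map proj₁ C.are-arcs }
      avoids : ∀ {p} → ¬ (p ∈ DirectedCycle.arcs cycle × p ∈ members)
      avoids (p∈ , p∈members) = proj₂ (All.lookup C.are-arcs p∈) p∈members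

    no-closed-walk : ∀ {c} → ¬ TransClosure Step c c
    no-closed-walk {inj₁ v} w = remaining-acyclic (vertex-walk w)
    -- Rotate the closed walk by one step so that it starts at a hub class.
    no-closed-walk {inj₂ (inj₁ e)} (leave _ a ∷ w) = remaining-acyclic (vertex-walk (w ∷ʳ leave e a))
    no-closed-walk {inj₂ (inj₁ e)} (stuck′ ∷ [ () ])
    no-closed-walk {inj₂ (inj₁ e)} (stuck′ ∷ () ∷ _)
    no-closed-walk {inj₂ (inj₂ i)} [ () ]
    no-closed-walk {inj₂ (inj₂ i)} (() ∷ _)

    quotient-acyclic : Acyclic (quotient Gadget partition)
    quotient-acyclic C = no-closed-walk (map-⁺ to quotient-step (walk⇒⁺ C.start C.rest C.are-arcs))
      where
      module C = DirectedCycle C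
      quotient-step : ∀ {i j} → Digraph.Arc (quotient Gadget partition) i j → Step (to i) (to j)
      quotient-step (i≢j , x , y , refl , refl , a) =
        subst₂ Step (sym (strictlyInverseˡ _)) (sym (strictlyInverseˡ _))
          (arc⇒Step a (i≢j ∘ cong from))

    acyclicHPartition : AcyclicHPartition Gadget parts
    acyclicHPartition = partition , hamiltonian , quotient-acyclic

  -- From an acyclic Hamiltonian partition to a feedback arc set

  module FromPartition {k : ℕ} (π : Partition Node k) (π-ok : IsAcyclicHPartition Gadget π) where
    open Partition π

    Within : Fin k → Node → Node → Set
    Within i x y = part x ≡ i × part y ≡ i × x ⟶ y

    part-connex : ∀ {x y} → part x ≡ part y →
                  x ≡ y ⊎ TransClosure (Within (part x)) x y ⊎ TransClosure (Within (part x)) y x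
    part-connex {x} {y} eq
      with linked-connex linked (spanning (x , refl)) (spanning (y , sym eq))
      where open HamiltonianPath (proj₁ π-ok (part x))
    ... | inj₁ e        = inj₁ (cong proj₁ e)
    ... | inj₂ (inj₁ w) = inj₂ (inj₁ (map-⁺ proj₁ (λ {(_ , p)} {(_ , q)} a → p , q , a) w))
    ... | inj₂ (inj₂ w) = inj₂ (inj₂ (map-⁺ proj₁ (λ {(_ , p)} {(_ , q)} a → p , q , a) w))

    within-< : ∀ {i x y} → TransClosure (Within i) x y → level x < level y
    within-< = ranked-⁺ level (level-< ∘ proj₂ ∘ proj₂)

    -- Distinct nodes of a part are joined by a walk inside it, along which the level strictly
    -- increases.
    level-injective : ∀ {x y} → part x ≡ part y → level x ≡ level y → x ≡ y
    level-injective eq l with part-connex eq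
    ... | inj₁ e        = e
    ... | inj₂ (inj₁ w) = contradiction (within-< w) (<-irrefl l)
    ... | inj₂ (inj₂ w) = contradiction (within-< w) (<-irrefl (sym l))

    ascending : ∀ {x y} → part x ≡ part y → level x < level y → TransClosure (Within (part x)) x y
    ascending eq l with part-connex eq
    ... | inj₁ refl     = contradiction l (<-irrefl refl)
    ... | inj₂ (inj₁ w) = w
    ... | inj₂ (inj₂ w) = contradiction (<-trans l (within-< w)) (<-irrefl refl)

    hub-injective : ∀ {v w} → part (hub v) ≡ part (hub w) → v ≡ w
    hub-injective eq with refl ← level-injective eq refl = refl

    -- The only arc out of `pre v` leads to `hub v`, so the walk up to `hub w` puts `hub v` into the
    -- same part.
    pre-with-hub : ∀ {v w} → part (pre v) ≡ part (hub w) → v ≡ w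
    pre-with-hub eq with ascending eq (s≤s z≤n)
    ... | [ _ , _ , pre⟶hub _ ] = refl
    ... | (_ , p , pre⟶hub _) ∷ _ = hub-injective (trans p eq)

    -- No arc leaves the top level, so the walk from `hub w` is a single arc, and only `hub v` has
    -- an arc to `post v`.
    post-with-hub : ∀ {v w} → part (post v) ≡ part (hub w) → v ≡ w
    post-with-hub eq with ascending (sym eq) (s≤s (s≤s z≤n))
    ... | [ _ , _ , hub⟶post _ ] = refl
    ... | (_ , _ , hub⟶post _) ∷ [ _ , _ , () ]
    ... | (_ , _ , hub⟶post _) ∷ (_ , _ , ()) ∷ _
    ... | (_ , _ , hub⟶entry _) ∷ [ _ , _ , () ]
    ... | (_ , _ , hub⟶entry _) ∷ (_ , _ , ()) ∷ _

    Hubless : Fin k → Set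
    Hubless i = ∀ v → part (hub v) ≢ i

    -- The second condition does not follow from the first: if `e` is a loop of `G` at `v`, then
    -- `exit e`, `hub v`, `entry e` is a path. Such an `e` has to count as cut.
    Intact : Pair → Set
    Intact e = part (exit e) ≡ part (entry e) × Hubless (part (exit e))

    intact? : ∀ e → Dec (Intact e)
    intact? e = (part (exit e) ≟ part (entry e)) ×-dec all? (λ v → ¬? (part (hub v) ≟ part (exit e)))

    -- A walk from level 0 to level 2 passes through a hub unless it is the single arc from an exit
    -- to its entry.
    hubless-intact : ∀ {i x y} → Hubless i → part x ≡ i → part y ≡ i → level x ≡ 0 → level y ≡ 2 →
                     ∃[ e ] (x ≡ exit e × y ≡ entry e × Intact e)
    hubless-intact {x = x} {y} h refl p lx ly
      with ascending {x} {y} (sym p) (subst₂ _<_ (sym lx) (sym ly) (s≤s z≤n))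
    ... | [ _ , q , exit⟶entry e ]     = e , refl , refl , sym q , h
    ... | (_ , q , pre⟶hub v) ∷ _      = contradiction q (h v)
    ... | (_ , q , exit⟶hub e _) ∷ _   = contradiction q (h (head e))
    ... | (_ , _ , exit⟶entry e) ∷ [ _ , _ , () ]
    ... | (_ , _ , exit⟶entry e) ∷ (_ , _ , ()) ∷ _
    ... | [ _ , _ , pre⟶hub _ ] with () ← ly
    ... | [ _ , _ , exit⟶hub _ _ ] with () ← ly

    Cut : Pair → Set
    Cut e = T (adj (tail e) (head e)) × ¬ Intact e

    cut? : ∀ e → Dec (Cut e)
    cut? e = T? (adj (tail e) (head e)) ×-dec ¬? (intact? e)

    cuts : List Pair
    cuts = filter cut? (allFin (n * n))

    cuts-unique : Unique cuts
    cuts-unique = Unique.filter⁺ cut? (Unique.allFin⁺ (n * n))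

    cut-at : ∀ i → ¬ Intact (List.lookup cuts i)
    cut-at i = proj₂ (proj₂ (∈-filter⁻ cut? {xs = allFin (n * n)} (∈-lookup {xs = cuts} i)))

    Uncut : Fin n → Fin n → Set
    Uncut u v = T (adj u v) × Intact (pair (u , v))

    -- The common part of `exit e` and `entry e` subdivides the arc: it is reached from `hub u`
    -- through the entry and left towards `hub v` through the exit. Being hubless, it differs from
    -- the parts of both hubs, as arcs of the quotient require.
    uncut-arcs : ∀ u v → Uncut u v →
                 TransClosure (Digraph.Arc (quotient Gadget π)) (part (hub u)) (part (hub v))
    uncut-arcs u v (a , same , h) =
      (h u ∘ (λ eq → trans eq (sym same)) , hub u , entry e , refl , refl ,
         subst (λ w → hub w ⟶ entry e) (cong proj₁ ends≡) (hub⟶entry e)) ∷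
      [ (λ eq → h v (trans (sym eq) (sym same))) , exit e , hub v , same , refl ,
         subst (λ w → exit e ⟶ hub w) (cong proj₂ ends≡)
           (exit⟶hub e (subst (T ∘ uncurry adj) (sym ends≡) a)) ]
      where
      e = pair (u , v)
      ends≡ : ends e ≡ (u , v)
      ends≡ = ends-pair (u , v)

    feedbackArcSet : FeedbackArcSet G
    feedbackArcSet = record
      { members  = map ends cuts
      ; distinct = Unique.map⁺ ends-injective cuts-unique
      ; are-arcs = All.tabulate λ p∈ → are-arcs p∈
      ; hits     = hits
      }
      where
      open DecMembership (≡-dec (_≟_ {n}) (_≟_ {n})) using (_∈?_)
      are-arcs : ∀ {p} → p ∈ map ends cuts → uncurry (λ u v → T (adj u v)) p
      are-arcs p∈ with e , e∈ , refl ← ∈-map⁻ ends p∈ =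
        proj₁ (proj₂ (∈-filter⁻ cut? {xs = allFin (n * n)} e∈))
      uncut : ∀ {u v} → T (adj u v) → (u , v) ∉ map ends cuts → Uncut u v
      uncut {u} {v} a ∉cuts with intact? (pair (u , v))
      ... | yes i = a , i
      ... | no ¬i = contradiction
        (subst (_∈ map ends cuts) (ends-pair (u , v))
          (∈-map⁺ ends (∈-filter⁺ cut? (∈-allFin _)
            (subst (T ∘ uncurry adj) (sym (ends-pair (u , v))) a , ¬i))))
        ∉cuts
      flatten : ∀ {u v} → TransClosure Uncut u v →
                TransClosure (Digraph.Arc (quotient Gadget π)) (part (hub u)) (part (hub v))
      flatten [ r ] = uncut-arcs _ _ r
      flatten (r ∷ w) = uncut-arcs _ _ r ⁺++ flatten w
      hits : (C : DirectedCycle G) → Any (_∈ map ends cuts) (DirectedCycle.arcs C)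
      hits C with Any.any? (_∈? map ends cuts) (DirectedCycle.arcs C)
      ... | yes p = p
      -- A cycle without cut arcs becomes a closed walk through the parts of its hubs, against
      -- acyclicity of the quotient.
      ... | no ¬p = contradiction
        (closed⇒cycle _≟_ (flatten (walk⇒⁺ C.start C.rest
          (All.zipWith (uncurry uncut) (C.are-arcs , ¬Any⇒All¬ _ ¬p)))))
        (proj₂ π-ok)
        where module C = DirectedCycle C

    -- Charging vertices, pairs and cut pairs to distinct parts

    hub-of? : ∀ i → Dec (∃[ v ] (part (hub v) ≡ i))
    hub-of? i = any? (λ v → part (hub v) ≟ i)

    -- If x shares its part with hub v, then x has displaced pre v (or post v), which
    -- is therefore alone: charge x to that part instead.
    charge : (Fin n → Node) → Node → Fin k
    charge spare x with hub-of? (part x)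
    ... | yes (v , _) = part (spare v)
    ... | no _        = part x

    data Charge (spare : Fin n → Node) (x : Node) : Fin k → Set where
      moved : ∀ {v} → part (hub v) ≡ part x → Charge spare x (part (spare v))
      kept  : Hubless (part x) → Charge spare x (part x)

    charge-view : ∀ spare x → Charge spare x (charge spare x)
    charge-view spare x with hub-of? (part x)
    ... | yes (v , p) = moved p
    ... | no ¬p       = kept λ v p → ¬p (v , p)

    -- Treats exits with `pre` and entries with `post` alike. Spares and items share the level
    -- `rank`, so no part contains one of each.
    record Side (spare : Fin n → Node) (item : Pair → Node) : Set where
      field
        rank         : ℕ
        spare-level  : ∀ v → level (spare v) ≡ rank
        item-level   : ∀ e → level (item e) ≡ rank
        with-hub     : ∀ {v w} → part (spare v) ≡ part (hub w) → v ≡ w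
        spare≢item   : ∀ {v e} → spare v ≢ item e
        spare-inj    : ∀ {v w} → spare v ≡ spare w → v ≡ w
        item-inj     : ∀ {e e′} → item e ≡ item e′ → e ≡ e′

    exits : Side pre exit
    exits = record
      { rank = 0 ; spare-level = λ _ → refl ; item-level = λ _ → refl ; with-hub = pre-with-hub
      ; spare≢item = λ () ; spare-inj = λ { refl → refl } ; item-inj = λ { refl → refl } }

    entries : Side post entry
    entries = record
      { rank = 2 ; spare-level = λ _ → refl ; item-level = λ _ → refl ; with-hub = post-with-hub
      ; spare≢item = λ () ; spare-inj = λ { refl → refl } ; item-inj = λ { refl → refl } }

    module _ {spare item} (side : Side spare item) where
      open Side side

      -- A hub sharing the part of `spare v` could only be `hub v`, but then the item absorbed by
      -- `hub v` would agree with `spare v` in part and level.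
      charge-hubless : ∀ e → Hubless (charge spare (item e))
      charge-hubless e with charge spare (item e) | charge-view spare (item e)
      ... | _ | kept h      = h
      ... | _ | moved {v} p = λ w q → spare≢item (level-injective
                (trans (trans (sym q) (cong (part ∘ hub) (sym (with-hub (sym q))))) p)
                (trans (spare-level v) (sym (item-level e))))

      -- Each charged part holds a node of level `rank`: the item itself if kept, a spare if moved.
      -- So equal parts are both kept or both moved; if moved, they have the same spare, hence both
      -- items lie in the part of one hub and coincide.
      charge-injective : ∀ e e′ → charge spare (item e) ≡ charge spare (item e′) → e ≡ e′
      charge-injective e e′ eq
        with charge spare (item e) | charge-view spare (item e)
           | charge spare (item e′) | charge-view spare (item e′)
      ... | _ | kept _      | _ | kept _       =
        item-inj (level-injective eq (trans (item-level e) (sym (item-level e′))))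
      ... | _ | kept _      | _ | moved {w} _  =
        contradiction (sym (level-injective eq (trans (item-level e) (sym (spare-level w))))) spare≢item
      ... | _ | moved {v} _ | _ | kept _       =
        contradiction (level-injective eq (trans (spare-level v) (sym (item-level e′)))) spare≢item
      ... | _ | moved {v} p | _ | moved {w} q
        with refl ← spare-inj (level-injective eq (trans (spare-level v) (sym (spare-level w)))) =
        item-inj (level-injective (trans (sym p) q) (trans (item-level e) (sym (item-level e′))))

      charge-source : ∀ e → ∃[ x ] (part x ≡ charge spare (item e) × level x ≡ rank ×
                                    (∀ e′ → x ≡ item e′ → e ≡ e′))
      charge-source e with charge spare (item e) | charge-view spare (item e)
      ... | _ | kept _      = item e , refl , item-level e , λ _ → item-inj
      ... | _ | moved {v} _ = spare v , refl , spare-level v , λ _ eq → contradiction eq spare≢item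

    slot : Fin n ⊎ (Pair ⊎ Fin (length cuts)) → Fin k
    slot (inj₁ v)        = part (hub v)
    slot (inj₂ (inj₁ e)) = charge pre (exit e)
    slot (inj₂ (inj₂ i)) = charge post (entry (List.lookup cuts i))

    -- A common part would be hubless with nodes at levels 0 and 2, hence would contain `exit e′`
    -- and `entry e′` for an intact `e′`. Its top node being `entry e′`, `y-item` identifies `e′`
    -- with the cut pair, which is not intact.
    exit≢cut : ∀ e i → charge pre (exit e) ≢ charge post (entry (List.lookup cuts i))
    exit≢cut e i eq
      with x , px , lx , _ ← charge-source exits e
         | y , py , ly , y-item ← charge-source entries (List.lookup cuts i)
      with e′ , _ , y≡ , intact ←
             hubless-intact (charge-hubless exits e) px (trans py (sym eq)) lx ly =
      cut-at i (subst Intact (sym (y-item e′ y≡)) intact)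

    slot-injective : ∀ {s t} → slot s ≡ slot t → s ≡ t
    slot-injective {inj₁ v} {inj₁ w} eq = cong inj₁ (hub-injective eq)
    slot-injective {inj₁ v} {inj₂ (inj₁ e)} eq = contradiction eq (charge-hubless exits e v)
    slot-injective {inj₁ v} {inj₂ (inj₂ i)} eq = contradiction eq (charge-hubless entries _ v)
    slot-injective {inj₂ (inj₁ e)} {inj₁ w} eq = contradiction (sym eq) (charge-hubless exits e w)
    slot-injective {inj₂ (inj₂ i)} {inj₁ w} eq = contradiction (sym eq) (charge-hubless entries _ w)
    slot-injective {inj₂ (inj₁ e)} {inj₂ (inj₁ e′)} eq =
      cong (inj₂ ∘ inj₁) (charge-injective exits e e′ eq)
    slot-injective {inj₂ (inj₁ e)} {inj₂ (inj₂ i)} eq = contradiction eq (exit≢cut e i)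
    slot-injective {inj₂ (inj₂ i)} {inj₂ (inj₁ e)} eq = contradiction (sym eq) (exit≢cut e i)
    slot-injective {inj₂ (inj₂ i)} {inj₂ (inj₂ j)} eq =
      cong (inj₂ ∘ inj₂) (lookup-injective cuts-unique (charge-injective entries _ _ eq))

    cuts-bound : n + (n * n + length cuts) ≤ k
    cuts-bound = injective⇒≤ {f = slot ∘ to} λ {i} {j} eq →
      trans (sym (strictlyInverseʳ i))
        (trans (cong from (slot-injective {to i} {to j} eq)) (strictlyInverseʳ j))
      where open Inverse (part-index (length cuts)) using (to; from; strictlyInverseʳ)

    size-bound : n + (n * n + FeedbackArcSet.size feedbackArcSet) ≤ k
    size-bound = subst (λ s → n + (n * n + s) ≤ k) (sym (length-map ends cuts)) cuts-bound

-- Words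

tabulate-splitAt : ∀ {A : Set} m {n} (g : Fin m ⊎ Fin n → A) →
                   tabulate (g ∘ splitAt m) ≡ tabulate (g ∘ inj₁) ++ tabulate (g ∘ inj₂)
tabulate-splitAt zero    g = refl
tabulate-splitAt (suc m) g = cong (g (inj₁ zero) ∷_) (tabulate-splitAt m (g ∘ Sum.map suc id))

-- `remQuot` runs through the pairs row by row, which lets a matrix in an encoding be treated as one
-- word indexed by pairs.
tabulate-remQuot : ∀ {A : Set} m n (g : Fin m × Fin n → A) →
                   tabulate (g ∘ remQuot {m} n) ≡ concat (tabulate λ u → tabulate λ v → g (u , v))
tabulate-remQuot zero    n g = refl
tabulate-remQuot (suc m) n g = trans
  (tabulate-splitAt n (g ∘ swap ∘ Sum.[ _, zero , Product.map₂ suc ∘ quotRem {m} n ]′))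
  (cong (tabulate (λ v → g (zero , v)) ++_) (tabulate-remQuot m n (λ (u , v) → g (suc u , v))))

concat-tabulate-combine : ∀ {A : Set} m n (g : Fin (m * n) → List A) →
  concat (tabulate g) ≡ concat (tabulate λ u → concat (tabulate λ v → g (combine {m} {n} u v)))
concat-tabulate-combine {A} m n g = begin
  concat (tabulate g)
    ≡⟨ cong concat (tabulate-cong (λ e → cong g (sym (combine-remQuot {m} n e)))) ⟩
  concat (tabulate (uncurry h ∘ remQuot {m} n))
    ≡⟨ cong concat (tabulate-remQuot m n (uncurry h)) ⟩
  concat (concat (tabulate λ u → tabulate (h u)))
    ≡⟨ concat-concat (tabulate λ u → tabulate (h u)) ⟨
  concat (map concat (tabulate λ u → tabulate (h u)))
    ≡⟨ cong concat (map-tabulate (λ u → tabulate (h u)) concat) ⟩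
  concat (tabulate λ u → concat (tabulate (h u))) ∎
  where
  open ≡-Reasoning
  h : Fin m → Fin n → List A
  h u v = g (combine {m} {n} u v)

concat-tabulate-singleton : ∀ {A : Set} {m} (g : Fin m → A) →
                            concat (tabulate λ i → g i ∷ []) ≡ tabulate g
concat-tabulate-singleton {m = zero}  g = refl
concat-tabulate-singleton {m = suc m} g = cong (g zero ∷_) (concat-tabulate-singleton (g ∘ suc))

tabulate-const : ∀ {A : Set} m (a : A) → tabulate {n = m} (const a) ≡ replicate m a
tabulate-const zero    a = refl
tabulate-const (suc m) a = cong (a ∷_) (tabulate-const m a)

length-concat-tabulate : ∀ {A : Set} {m} l (g : Fin m → List A) → (∀ i → length (g i) ≡ l) →
                         length (concat (tabulate g)) ≡ m * l
length-concat-tabulate {m = zero}  l g eq = refl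
length-concat-tabulate {m = suc m} l g eq =
  trans (length-++ (g zero)) (cong₂ _+_ (eq zero) (length-concat-tabulate l (g ∘ suc) (eq ∘ suc)))

length-unary : ∀ m → length (unary m) ≡ suc m
length-unary zero    = refl
length-unary (suc m) = cong suc (length-unary m)

codeLength : ℕ → ℕ → ℕ
codeLength n k = suc n + (suc k + n * n)

length-encode : ∀ G k → length (encodeGraphWithBound G k) ≡ codeLength (FinDigraph.order G) k
length-encode G k =
  trans (length-++ (unary order)) (cong₂ _+_ (length-unary order)
    (trans (length-++ (unary k)) (cong₂ _+_ (length-unary k)
      (length-concat-tabulate order (λ u → tabulate (adj u)) (λ u → length-tabulate (adj u))))))
  where open FinDigraph G

-- A language of tape programs

Sym : Set
Sym = Symbol 0

data Op : Set where
  idle goL goR : Op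
  set put      : Bool → Op

compile : Op → Sym → Sym × Move
compile idle    s = s , stay
compile goL     s = s , left
compile goR     s = s , right
compile (set b) s = bit b , stay
compile (put b) s = bit b , right

data Prog (k : ℕ) : Set where
  act   : Fin k → (Vec Sym k → Op) → Prog k
  _⨾_   : Prog k → Prog k → Prog k
  while : (Vec Sym k → Bool) → Prog k → Prog k

infixr 5 _⨾_

actions : ∀ {k} → Fin k → Op → Vec Sym k → Vec (Sym × Move) k
actions zero    o (s ∷ ss) = compile o s ∷ Vec.map (_, stay) ss
actions (suc r) o (s ∷ ss) = (s , stay) ∷ actions r o ss

module _ {k : ℕ} where

  St : Prog k → Set
  St (act _ _)   = ⊤
  St (p ⨾ q)     = St p ⊎ St q
  St (while _ p) = ⊤ ⊎ St p

  init : ∀ p → St p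
  init (act _ _)   = tt
  init (p ⨾ q)     = inj₁ (init p)
  init (while _ p) = inj₁ tt

  states : Prog k → ℕ
  states (act _ _)   = 1
  states (p ⨾ q)     = states p + states q
  states (while _ p) = 1 + states p

  St-finite : ∀ p → St p ↔ Fin (states p)
  St-finite (act _ _)   = ↔-sym 1↔⊤
  St-finite (p ⨾ q)     = ↔-sym +↔⊎ ↔-∘ (St-finite p ⊎-↔ St-finite q)
  St-finite (while _ p) = ↔-sym +↔⊎ ↔-∘ (↔-sym 1↔⊤ ⊎-↔ St-finite p)

  resume : ∀ {p q} → Maybe (St p) → Maybe (St (p ⨾ q))
  resume {q = q} = just ∘ maybe inj₁ (inj₂ (init q))

  repeat : ∀ {c p} → Maybe (St p) → Maybe (St (while c p))
  repeat = just ∘ maybe inj₂ (inj₁ tt)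

  -- The value `nothing` says that the program ends with this step. A composition then passes to its
  -- second program in the same step, so joining costs no time; a loop test is one step that changes
  -- no tape.
  next : ∀ p → St p → Vec Sym k → Maybe (St p) × Vec (Sym × Move) k
  next (act r f)   tt       ss = nothing , actions r (f ss) ss
  next (p ⨾ q)     (inj₁ s) ss = Product.map₁ (resume {p} {q}) (next p s ss)
  next (p ⨾ q)     (inj₂ s) ss = Product.map₁ (Maybe.map inj₂) (next q s ss)
  next (while c p) (inj₁ tt) ss = (if c ss then just (inj₂ (init p)) else nothing) , Vec.map (_, stay) ss
  next (while c p) (inj₂ s) ss = Product.map₁ (repeat {c} {p}) (next p s ss)

  scanAll : Vec (Tape 0) k → Vec Sym k
  scanAll = Vec.map Tape.scanned

  data Exits (p : Prog k) : St p → Vec (Tape 0) k → ℕ → Vec (Tape 0) k → Set where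
    stop : ∀ {s ts as} → next p s (scanAll ts) ≡ (nothing , as) →
           Exits p s ts 1 (Vec.zipWith writeMove ts as)
    cont : ∀ {s s′ ts as t ts′} → next p s (scanAll ts) ≡ (just s′ , as) →
           Exits p s′ (Vec.zipWith writeMove ts as) t ts′ → Exits p s ts (suc t) ts′

  exits-second : ∀ {p q s ts t ts′} → Exits q s ts t ts′ → Exits (p ⨾ q) (inj₂ s) ts t ts′
  exits-second (stop e)   = stop (cong (Product.map₁ (Maybe.map inj₂)) e)
  exits-second (cont e x) = cont (cong (Product.map₁ (Maybe.map inj₂)) e) (exits-second x)

  exits-first : ∀ {p q s ts t ts₁ t′ ts₂} → Exits p s ts t ts₁ → Exits q (init q) ts₁ t′ ts₂ →
                Exits (p ⨾ q) (inj₁ s) ts (t + t′) ts₂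
  exits-first {p} {q} (stop e)   y = cont (cong (Product.map₁ (resume {p} {q})) e) (exits-second y)
  exits-first {p} {q} (cont e x) y = cont (cong (Product.map₁ (resume {p} {q})) e) (exits-first x y)

  exits-body : ∀ {c p s ts t ts₁ t′ ts₂} → Exits p s ts t ts₁ →
               Exits (while c p) (inj₁ tt) ts₁ t′ ts₂ →
               Exits (while c p) (inj₂ s) ts (t + t′) ts₂
  exits-body {c} {p} (stop e)   y = cont (cong (Product.map₁ (repeat {c} {p})) e) y
  exits-body {c} {p} (cont e x) y = cont (cong (Product.map₁ (repeat {c} {p})) e) (exits-body x y)

module _ {w : ℕ} where

  -- The added state `inj₁ tt` is the halting state. It is entered in the last step of the program,
  -- so machine and program take equally many steps.
  machine : Prog (suc w) → TuringMachine
  machine p = record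
    { State        = ⊤ ⊎ St p
    ; stateCount   = 1 + states p
    ; state-finite = ↔-sym +↔⊎ ↔-∘ (↔-sym 1↔⊤ ⊎-↔ St-finite p)
    ; start        = inj₂ (init p)
    ; auxSymbols   = 0
    ; workTapes    = w
    ; δ            = λ
        { (inj₁ tt) _ → nothing
        ; (inj₂ s) ss → just (Product.map₁ (maybe inj₂ (inj₁ tt)) (next p s ss))
        }
    }

  module _ (p : Prog (suc w)) where
    open TuringMachine (machine p) using (Config; config; _⇓[_]_; steps; halted)

    enact : Vec (Tape 0) (suc w) → Maybe (St p) × Vec (Sym × Move) (suc w) → Maybe Config
    enact ts (m , as) = just (config (maybe inj₂ (inj₁ tt) m) (Vec.zipWith writeMove ts as))

    exits⇒halts : ∀ {s ts t ts′} → Exits p s ts t ts′ → config (inj₂ s) ts ⇓[ t ] config (inj₁ tt) ts′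
    exits⇒halts {ts = ts} (stop e)   = steps (cong (enact ts) e) (halted refl)
    exits⇒halts {ts = ts} (cont e x) = steps (cong (enact ts) e) (exits⇒halts x)

-- Symbolic execution on tape shapes

focus : List Sym → List Sym → Tape 0
focus ls []       = tape ls blank []
focus ls (r ∷ rs) = tape ls r rs

-- Tapes are lists that are not identified up to trailing blanks: once the head has visited the
-- blank after a word, that blank stays in the list.
cells : List Bool → List Sym
cells bs = map bit bs ++ blank ∷ []

-- The tape shapes that occur in the runs below. In `at b ls rs` the head scans the
-- first symbol of rs; ls (nearest first) and rs form a word that is delimited by a
-- blank on either side, and b lies beyond the left blank, which is scanned in
-- `before b rs`. `raw` makes `perform` total.
data Shape : Set where
  at     : List Sym → (ls rs : List Bool) → Shape
  before : List Sym → List Bool → Shape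
  input  : (ls rs : List Bool) → Shape
  raw    : Tape 0 → Shape

concrete : Shape → Tape 0
concrete (at b ls rs)  = focus (map bit ls ++ blank ∷ b) (cells rs)
concrete (before b rs) = tape b blank (cells rs)
concrete (input ls rs) = focus (map bit ls) (map bit rs)
concrete (raw t)       = t

scan : Shape → Sym
scan x = Tape.scanned (concrete x)

perform : Op → Shape → Shape
perform idle    x                   = x
perform goL     (at b (l ∷ ls) rs)  = at b ls (l ∷ rs)
perform goL     (at b [] rs)        = before b rs
perform goR     (at b ls (r ∷ rs))  = at b (r ∷ ls) rs
perform goR     (before b rs)       = at b [] rs
perform goR     (input ls (r ∷ rs)) = input (r ∷ ls) rs
-- The blank just passed becomes the left delimiter of a new word. On tape zero this leaves the
-- input beyond it, and the output is written to its right.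
perform goR     (input ls [])       = at (map bit ls) [] []
perform (set c) (at b ls (r ∷ rs))  = at b ls (c ∷ rs)
perform (put c) (at b ls [])        = at b (c ∷ ls) []
perform o       x                   = raw (writeMove (concrete x) (compile o (scan x)))

perform-concrete : ∀ o x → writeMove (concrete x) (compile o (scan x)) ≡ concrete (perform o x)
perform-concrete idle    x                         = refl
perform-concrete goL     (at b (l ∷ ls) [])        = refl
perform-concrete goL     (at b (l ∷ ls) (_ ∷ _))   = refl
perform-concrete goL     (at b [] [])              = refl
perform-concrete goL     (at b [] (_ ∷ _))         = refl
perform-concrete goL     (before b rs)             = refl
perform-concrete goL     (input ls rs)             = refl
perform-concrete goL     (raw t)                   = refl
perform-concrete goR     (at b ls [])              = refl
perform-concrete goR     (at b ls (r ∷ []))        = refl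
perform-concrete goR     (at b ls (r ∷ _ ∷ _))     = refl
perform-concrete goR     (before b [])             = refl
perform-concrete goR     (before b (_ ∷ _))        = refl
perform-concrete goR     (input ls [])             = refl
perform-concrete goR     (input ls (r ∷ []))       = refl
perform-concrete goR     (input ls (r ∷ _ ∷ _))    = refl
perform-concrete goR     (raw t)                   = refl
perform-concrete (set c) (at b ls [])              = refl
perform-concrete (set c) (at b ls (r ∷ rs))        = refl
perform-concrete (set c) (before b rs)             = refl
perform-concrete (set c) (input ls rs)             = refl
perform-concrete (set c) (raw t)                   = refl
perform-concrete (put c) (at b ls [])              = refl
perform-concrete (put c) (at b ls (r ∷ rs))        = refl
perform-concrete (put c) (before b rs)             = refl
perform-concrete (put c) (input ls rs)             = refl
perform-concrete (put c) (raw t)                   = refl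

concreteAll : ∀ {k} → Vec Shape k → Vec (Tape 0) k
concreteAll = Vec.map concrete

scans : ∀ {k} → Vec Shape k → Vec Sym k
scans xs = Vec.map Tape.scanned (concreteAll xs)

stay-all : ∀ {k} (ts : Vec (Tape 0) k) →
           Vec.zipWith writeMove ts (Vec.map (_, stay) (Vec.map Tape.scanned ts)) ≡ ts
stay-all []       = refl
stay-all (t ∷ ts) = cong (t ∷_) (stay-all ts)

actions-perform : ∀ {k} (r : Fin k) o xs →
  Vec.zipWith writeMove (concreteAll xs) (actions r o (scans xs)) ≡
  concreteAll (xs [ r ]≔ perform o (lookup xs r))
actions-perform zero    o (x ∷ xs) = cong₂ _∷_ (perform-concrete o x) (stay-all (concreteAll xs))
actions-perform (suc r) o (x ∷ xs) = cong (concrete x ∷_) (actions-perform r o xs)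

-- Executions with bounded loops and their running time

time : ∀ {k} → ℕ → Prog k → ℕ
time S (act _ _)   = 1
time S (p ⨾ q)     = time S p + time S q
-- Every iteration pays for its body and one test; the final 1 is the failing test.
time S (while _ p) = S * suc (time S p) + 1

module Runs {k : ℕ} (S : ℕ) where

  mutual
    data Run : Prog k → Vec Shape k → Vec Shape k → Set where
      act   : ∀ {r f xs ys} → xs [ r ]≔ perform (f (scans xs)) (lookup xs r) ≡ ys → Run (act r f) xs ys
      _⨾_   : ∀ {p q xs ys zs} → Run p xs ys → Run q ys zs → Run (p ⨾ q) xs zs
      while : ∀ {c p m xs ys} → m ≤ S → Iterate c p m xs ys → Run (while c p) xs ys

    data Iterate (c : Vec Sym k → Bool) (p : Prog k) : ℕ → Vec Shape k → Vec Shape k → Set where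
      done : ∀ {xs} → c (scans xs) ≡ false → Iterate c p 0 xs xs
      once : ∀ {m xs ys zs} → c (scans xs) ≡ true → Run p xs ys → Iterate c p m ys zs →
             Iterate c p (suc m) xs zs

  while-done : ∀ {c : Vec Sym k → Bool} {p ts} → c (scanAll ts) ≡ false →
               Exits (while c p) (inj₁ tt) ts 1 ts
  while-done {c} {p} {ts} e = subst (Exits (while c p) (inj₁ tt) ts 1) (stay-all ts)
    (stop (cong (λ b → (if b then just (inj₂ (init p)) else nothing) , Vec.map (_, stay) (scanAll ts)) e))

  while-once : ∀ {c : Vec Sym k → Bool} {p ts t ts′} → c (scanAll ts) ≡ true →
               Exits (while c p) (inj₂ (init p)) ts t ts′ → Exits (while c p) (inj₁ tt) ts (suc t) ts′
  while-once {c} {p} {ts} {t} {ts′} e x =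
    cont (cong (λ b → (if b then just (inj₂ (init p)) else nothing) , Vec.map (_, stay) (scanAll ts)) e)
      (subst (λ u → Exits (while c p) (inj₂ (init p)) u t ts′) (sym (stay-all ts)) x)

  mutual
    run⇒exits : ∀ {p xs ys} → Run p xs ys →
                ∃[ t ] (t ≤ time S p × Exits p (init p) (concreteAll xs) t (concreteAll ys))
    run⇒exits {act r f} {xs} (act refl) = 1 , ≤-refl ,
      subst (Exits (act r f) tt (concreteAll xs) 1) (actions-perform r _ xs) (stop refl)
    run⇒exits (x ⨾ y) with t , t≤ , ex ← run⇒exits x | u , u≤ , ey ← run⇒exits y =
      t + u , +-mono-≤ t≤ u≤ , exits-first ex ey
    run⇒exits {while c p} (while m≤S i) with t , t≤ , e ← iterate⇒exits i =
      t , ≤-trans t≤ (ℕ.+-monoˡ-≤ 1 (ℕ.*-monoˡ-≤ (suc (time S p)) m≤S)) , e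

    iterate⇒exits : ∀ {c p m xs ys} → Iterate c p m xs ys →
                    ∃[ t ] (t ≤ m * suc (time S p) + 1 ×
                            Exits (while c p) (inj₁ tt) (concreteAll xs) t (concreteAll ys))
    iterate⇒exits (done e) = 1 , ≤-refl , while-done e
    iterate⇒exits {p = p} {suc m} (once e x i)
      with t , t≤ , ex ← run⇒exits x | u , u≤ , ei ← iterate⇒exits i =
      suc (t + u) ,
      s≤s (≤-trans (+-mono-≤ t≤ u≤) (≤-reflexive (sym (ℕ.+-assoc (time S p) (m * suc (time S p)) 1)))) ,
      while-once e (exits-body ex ei)

-- The exponent is the nesting depth of loops. For nonzero `S`, powers can be raised to a common
-- exponent and can absorb additive constants.
time-polynomial : ∀ {k} (p : Prog k) → ∃₂ λ c d → ∀ S → .{{NonZero S}} → time S p ≤ c * S ^ d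
time-polynomial (act _ _) = 1 , 0 , λ S → ≤-refl
time-polynomial (p ⨾ q) with c , d , p≤ ← time-polynomial p | c′ , d′ , q≤ ← time-polynomial q =
  c + c′ , d ⊔ d′ , λ S → begin
    time S p + time S q                    ≤⟨ +-mono-≤ (p≤ S) (q≤ S) ⟩
    c * S ^ d + c′ * S ^ d′                ≤⟨ +-mono-≤ (ℕ.*-monoʳ-≤ c (ℕ.^-monoʳ-≤ S (ℕ.m≤m⊔n d d′)))
                                                       (ℕ.*-monoʳ-≤ c′ (ℕ.^-monoʳ-≤ S (ℕ.m≤n⊔m d d′))) ⟩
    c * S ^ (d ⊔ d′) + c′ * S ^ (d ⊔ d′)   ≡⟨ ℕ.*-distribʳ-+ (S ^ (d ⊔ d′)) c c′ ⟨
    (c + c′) * S ^ (d ⊔ d′)                ∎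
  where open ℕ.≤-Reasoning
time-polynomial (while _ p) with c , d , p≤ ← time-polynomial p =
  -- The 2 covers the `S` successful tests and the failing one, each bounded by `S ^ suc d`.
  2 + c , suc d , λ S → begin
    S * suc (time S p) + 1                    ≡⟨ cong (_+ 1) (ℕ.*-suc S (time S p)) ⟩
    S + S * time S p + 1                      ≤⟨ +-mono-≤ (+-mono-≤ (base S) (ℕ.*-monoʳ-≤ S (p≤ S)))
                                                          (ℕ.m^n>0 S (suc d)) ⟩
    S ^ suc d + S * (c * S ^ d) + S ^ suc d   ≡⟨ regroup S (S ^ d) c ⟩
    (2 + c) * S ^ suc d                       ∎
  where
  open ℕ.≤-Reasoning
  base : ∀ S .{{_ : NonZero S}} → S ≤ S * S ^ d
  base S = ℕ.m≤m*n S (S ^ d) {{ℕ.m^n≢0 S d}}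
  regroup : ∀ S P c → S * P + S * (c * P) + S * P ≡ (2 + c) * (S * P)
  regroup = solve-∀

-- Programs that walk over tapes and emit words

isBit isZero isOne : Sym → Bool
isBit (bit _) = true
isBit _       = false
isZero (bit false) = true
isZero _           = false
isOne (bit true) = true
isOne _          = false

isOne-bit : ∀ b → isOne (bit b) ≡ b
isOne-bit true  = refl
isOne-bit false = refl

remarkOp : Sym → Op
remarkOp (bit _) = set true
remarkOp _       = idle

oneHot : ∀ m → ℕ → Fin m → Bool
oneHot m k j = k ≡ᵇ toℕ j

markHead : List Bool → List Bool
markHead []       = []
markHead (_ ∷ bs) = true ∷ bs

-- Both words are cut at the old mark and share the remainder `rs`; if `rs` is empty, the mark
-- disappears.
oneHot-next : ∀ {m} (i : Fin m) → ∃[ rs ]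
  ( tabulate (oneHot m (toℕ i)) ≡ replicate (toℕ i) false ++ true ∷ rs
  × tabulate (oneHot m (suc (toℕ i))) ≡ replicate (toℕ i) false ++ false ∷ markHead rs)
oneHot-next {suc zero}    zero    = [] , refl , refl
oneHot-next {suc (suc m)} zero    = tabulate (λ _ → false) , refl , refl
oneHot-next {suc m}       (suc i) with rs , eq , eq′ ← oneHot-next i =
  rs , cong (false ∷_) eq , cong (false ∷_) eq′

oneHot-end : ∀ m → tabulate (oneHot m m) ≡ tabulate {n = m} (const false)
oneHot-end zero    = refl
oneHot-end (suc m) = cong (false ∷_) (oneHot-end m)

cursor : List Bool → ℕ → List Bool → Shape
cursor ls zero    rs       = at [] ls rs
cursor ls (suc k) []       = at [] ls []
cursor ls (suc k) (r ∷ rs) = cursor (r ∷ ls) k rs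

-- For `k` equal to `m` the head is on the blank after the word, where a `foreach` stops.
word : ∀ {m} → ℕ → (Fin m → Bool) → Shape
word k g = cursor [] k (tabulate g)

cursor-scan : ∀ {m} (g : Fin m → Bool) ls i → scan (cursor ls (toℕ i) (tabulate g)) ≡ bit (g i)
cursor-scan g ls zero    = refl
cursor-scan g ls (suc i) = cursor-scan (g ∘ suc) (g zero ∷ ls) i

cursor-right : ∀ {m} (g : Fin m → Bool) ls (i : Fin m) →
               perform goR (cursor ls (toℕ i) (tabulate g)) ≡ cursor ls (suc (toℕ i)) (tabulate g)
cursor-right g ls zero    = refl
cursor-right g ls (suc i) = cursor-right (g ∘ suc) (g zero ∷ ls) i

cursor-end : ∀ {m} (g : Fin m → Bool) ls → cursor ls m (tabulate g) ≡ at [] (tabulate g ʳ++ ls) []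
cursor-end {zero}  g ls = refl
cursor-end {suc m} g ls = cursor-end (g ∘ suc) (g zero ∷ ls)

module _ {k : ℕ} where

  act₁ : Fin k → (Sym → Op) → Prog k
  act₁ r h = act r (λ ss → h (lookup ss r))

  while₁ : Fin k → (Sym → Bool) → Prog k → Prog k
  while₁ r c = while (λ ss → c (lookup ss r))

  goLeft goRight rewind : Fin k → Prog k
  goLeft  r = act₁ r (const goL)
  goRight r = act₁ r (const goR)
  rewind  r = goLeft r ⨾ while₁ r isBit (goLeft r) ⨾ goRight r

  -- Shifts the mark of a one-hot word by one cell, dropping it at the end of the word.
  advance : Fin k → Prog k
  advance r =
    while₁ r isZero (goRight r) ⨾ act₁ r (const (set false)) ⨾ goRight r ⨾
    act₁ r remarkOp ⨾ rewind r

  mark : Fin k → Prog k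
  mark r = act₁ r (const (set true))

  foreach : Fin k → Prog k → Prog k
  foreach r p = while₁ r isBit (p ⨾ goRight r) ⨾ rewind r

  lookup-scans : ∀ r (xs : Vec Shape k) → lookup (scans xs) r ≡ scan (lookup xs r)
  lookup-scans r xs = trans (lookup-map r Tape.scanned (concreteAll xs))
                            (cong Tape.scanned (lookup-map r concrete xs))

  scans-update : ∀ r (xs : Vec Shape k) x → lookup (scans (xs [ r ]≔ x)) r ≡ scan x
  scans-update r xs x = trans (lookup-scans r (xs [ r ]≔ x)) (cong scan (lookup∘update r xs x))

  restore : ∀ {r} {xs : Vec Shape k} {x} → lookup xs r ≡ x → xs [ r ]≔ x ≡ xs
  restore {r} {xs} refl = []≔-lookup xs r

  module Single (S : ℕ) where
    open Runs {k} S

    act₁-run : ∀ r {h} {xs : Vec Shape k} {x} →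
               Run (act₁ r h) (xs [ r ]≔ x) (xs [ r ]≔ perform (h (scan x)) x)
    act₁-run r {h} {xs} {x} = act (trans ([]≔-idempotent xs r)
      (cong (xs [ r ]≔_) (cong₂ (λ s y → perform (h s) y) (scans-update r xs x) (lookup∘update r xs x))))

    at-update : ∀ {p r} {xs ys : Vec Shape k} {x} → lookup xs r ≡ x → Run p (xs [ r ]≔ x) ys → Run p xs ys
    at-update {p} eq = subst (λ zs → Run p zs _) (restore eq)

    rewind-run : ∀ r {xs : Vec Shape k} {b rs} ls → length ls ≤ S → lookup xs r ≡ at b ls rs →
                 Run (rewind r) xs (xs [ r ]≔ at b [] (ls ʳ++ rs))
    rewind-run r {xs} {b} ls len eq = at-update eq (rewinds ls len)
      where
      iterate : ∀ ls {l rs} → Iterate (λ ss → isBit (lookup ss r)) (goLeft r) (suc (length ls))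
                  (xs [ r ]≔ at b ls (l ∷ rs)) (xs [ r ]≔ before b (ls ʳ++ (l ∷ rs)))
      iterate [] = once (cong isBit (scans-update r xs _)) (act₁-run r)
                        (done (cong isBit (scans-update r xs _)))
      iterate (_ ∷ ls) = once (cong isBit (scans-update r xs _)) (act₁-run r) (iterate ls)
      rewinds : ∀ ls {rs} → length ls ≤ S →
                Run (rewind r) (xs [ r ]≔ at b ls rs) (xs [ r ]≔ at b [] (ls ʳ++ rs))
      rewinds []       len = act₁-run r ⨾ while z≤n (done (cong isBit (scans-update r xs _))) ⨾ act₁-run r
      rewinds (_ ∷ ls) len = act₁-run r ⨾ while len (iterate ls) ⨾ act₁-run r

    rewind-word : ∀ r {xs : Vec Shape k} {b} us → length us ≤ S → lookup xs r ≡ at b (us ʳ++ []) [] →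
                  Run (rewind r) xs (xs [ r ]≔ at b [] us)
    rewind-word r {xs} {b} us len eq =
      subst (λ vs → Run (rewind r) xs (xs [ r ]≔ at b [] vs))
        (trans (ʳ++-ʳ++ us) (++-identityʳ us))
        (rewind-run r (us ʳ++ []) (subst (_≤ S) (sym (trans (length-ʳ++ us) (ℕ.+-identityʳ _))) len) eq)

    -- On an empty word the head would scan the delimiting blank and the mark would lengthen the
    -- word, hence `0 < m`.
    mark-run : ∀ r {xs : Vec Shape k} {m} → 0 < m → lookup xs r ≡ word 0 (oneHot m m) →
               Run (mark r) xs (xs [ r ]≔ word 0 (oneHot m 0))
    mark-run r {xs} {suc m} _ eq = subst (Run (mark r) xs)
      (cong (λ bs → xs [ r ]≔ at [] [] (true ∷ bs)) (oneHot-end m))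
      (at-update eq (act₁-run r))

    advance-run : ∀ r {xs : Vec Shape k} {m} (i : Fin m) → m ≤ S →
                  lookup xs r ≡ word 0 (oneHot m (toℕ i)) →
                  Run (advance r) xs (xs [ r ]≔ word 0 (oneHot m (suc (toℕ i))))
    advance-run r {xs} {m} i m≤S eq with rs , now , later ← oneHot-next i =
      at-update (trans eq (cong (at [] []) now))
        (subst (λ bs → Run (advance r) (xs [ r ]≔ at [] [] (z ++ true ∷ rs)) (xs [ r ]≔ at [] [] bs))
          (sym later) run)
      where
      z = replicate (toℕ i) false
      seek : ∀ j ls → Iterate (λ ss → isZero (lookup ss r)) (goRight r) j
               (xs [ r ]≔ at [] ls (replicate j false ++ true ∷ rs))
               (xs [ r ]≔ at [] (replicate j false ʳ++ ls) (true ∷ rs))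
      seek zero    ls = done (cong isZero (scans-update r xs _))
      seek (suc j) ls = once (cong isZero (scans-update r xs _)) (act₁-run r) (seek j (false ∷ ls))
      length-z : length (z ʳ++ []) ≡ toℕ i
      length-z = trans (length-ʳ++ z) (trans (ℕ.+-identityʳ _) (length-replicate (toℕ i)))
      i<S : toℕ i < S
      i<S = ≤-trans (toℕ<n i) m≤S
      remark : ∀ rs {ls} → perform (remarkOp (scan (at [] ls rs))) (at [] ls rs)
                           ≡ at [] ls (markHead rs)
      remark []      = refl
      remark (_ ∷ _) = refl
      run : Run (advance r) (xs [ r ]≔ at [] [] (z ++ true ∷ rs))
                            (xs [ r ]≔ at [] [] (z ++ false ∷ markHead rs))
      run = while (ℕ.<⇒≤ i<S) (seek (toℕ i) []) ⨾ act₁-run r ⨾ act₁-run r ⨾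
        subst (Run (act₁ r remarkOp) (xs [ r ]≔ at [] (false ∷ (z ʳ++ [])) rs))
          (cong (xs [ r ]≔_) (remark rs)) (act₁-run r {remarkOp}) ⨾
        subst (Run (rewind r) (xs [ r ]≔ at [] (false ∷ (z ʳ++ [])) (markHead rs)))
          (trans ([]≔-idempotent xs r) (cong (λ bs → xs [ r ]≔ at [] [] bs) (ʳ++-ʳ++ z)))
          (rewind-run r (false ∷ (z ʳ++ []))
            (subst (_≤ S) (cong suc (sym length-z)) i<S)
            (lookup∘update r xs _))

module _ {w : ℕ} where

  bitAt : Fin w → Vec Sym (suc w) → Bool
  bitAt r ss = isOne (lookup ss (suc r))

  emit : (Vec Sym (suc w) → Bool) → Prog (suc w)
  emit f = act zero (put ∘ f)

  fill : Fin w → Bool → Prog (suc w)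
  fill r b = foreach (suc r) (emit (const b))

  copy : Fin w → Prog (suc w)
  copy r = foreach (suc r) (emit (bitAt r))

-- Programs that append words to the output

module Emission {w : ℕ} (base : List Sym) (S : ℕ) where
  open Runs {suc w} S
  open Single {suc w} S

  out : List Bool → Shape
  out acc = at base acc []

  -- acc is the reversed output written so far.
  record Emits (p : Prog (suc w)) (xs : Vec Shape w) (u : List Bool) (ys : Vec Shape w) : Set where
    constructor emits
    field
      run : ∀ acc → Run p (out acc ∷ xs) (out (u ʳ++ acc) ∷ ys)

  open Emits public

  infixr 5 _▷_ _▹_

  _▷_ : ∀ {p q xs ys zs u v} → Emits p xs u ys → Emits q ys v zs → Emits (p ⨾ q) xs (u ++ v) zs
  _▷_ {p} {q} {xs} {ys} {zs} {u} x y = emits λ acc →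
    subst (λ a → Run (p ⨾ q) (out acc ∷ xs) (out a ∷ zs)) (sym (++-ʳ++ u)) (run x acc ⨾ run y (u ʳ++ acc))

  -- Composition with a program that writes nothing, stated so that no `u ++ []` arises.
  _▹_ : ∀ {p q xs ys zs u} → Emits p xs u ys → Emits q ys [] zs → Emits (p ⨾ q) xs u zs
  _▹_ {u = u} x y = emits λ acc → run x acc ⨾ run y (u ʳ++ acc)

  emit-emits : ∀ {f xs c} → f (blank ∷ scans xs) ≡ c → Emits (emit f) xs (c ∷ []) xs
  emit-emits refl = emits λ acc → act refl

  while-emits : ∀ {c p} m (St : ℕ → Vec Shape w) (u : Fin m → List Bool) → m ≤ S →
                (∀ (i : Fin m) → c (blank ∷ scans (St (toℕ i))) ≡ true) → c (blank ∷ scans (St m)) ≡ false →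
                (∀ i → Emits p (St (toℕ i)) (u i) (St (suc (toℕ i)))) →
                Emits (while c p) (St 0) (concat (tabulate u)) (St m)
  while-emits {c} {p} m St u m≤S go halt body = emits λ acc → while m≤S (iterate m St u go halt body acc)
    where
    iterate : ∀ m (St : ℕ → Vec Shape w) (u : Fin m → List Bool) →
              (∀ (i : Fin m) → c (blank ∷ scans (St (toℕ i))) ≡ true) → c (blank ∷ scans (St m)) ≡ false →
              (∀ i → Emits p (St (toℕ i)) (u i) (St (suc (toℕ i)))) → ∀ acc →
              Iterate c p m (out acc ∷ St 0) (out (concat (tabulate u) ʳ++ acc) ∷ St m)
    iterate zero    St u go halt body acc = done halt
    iterate (suc m) St u go halt body acc =
      subst (λ a → Iterate c p (suc m) (out acc ∷ St 0) (out a ∷ St (suc m))) (sym (++-ʳ++ (u zero)))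
        (once (go zero) (run (body zero) acc)
          (iterate m (St ∘ suc) (u ∘ suc) (go ∘ suc) halt (body ∘ suc) (u zero ʳ++ acc)))

  -- Component r of B k is immaterial.
  foreach-emits : ∀ r {p m} (g : Fin m → Bool) (B : ℕ → Vec Shape w) (u : Fin m → List Bool) → m ≤ S →
    (∀ i → Emits p (B (toℕ i) [ r ]≔ word (toℕ i) g) (u i) (B (suc (toℕ i)) [ r ]≔ word (toℕ i) g)) →
    Emits (foreach (suc r) p) (B 0 [ r ]≔ word 0 g) (concat (tabulate u)) (B m [ r ]≔ word 0 g)
  foreach-emits r {p} {m} g B u m≤S body =
    while-emits m (λ k → B k [ r ]≔ word k g) u m≤S
      (λ i → cong isBit (trans (scans-update r (B (toℕ i)) _) (cursor-scan g [] i)))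
      (cong isBit (trans (scans-update r (B m) _) (cong scan (cursor-end g []))))
      (λ i → body i ▹ step i)
    ▹ emits λ acc → subst (λ xs → Run (rewind (suc r)) (out acc ∷ B m [ r ]≔ word m g) (out acc ∷ xs))
        ([]≔-idempotent (B m) r)
        (rewind-word (suc r) {out acc ∷ B m [ r ]≔ word m g} (tabulate g)
           (subst (_≤ S) (sym (length-tabulate g)) m≤S)
           (trans (lookup∘update r (B m) _) (cursor-end g [])))
    where
    step : ∀ i → Emits (goRight (suc r)) (B (suc (toℕ i)) [ r ]≔ word (toℕ i) g) []
                       (B (suc (toℕ i)) [ r ]≔ word (suc (toℕ i)) g)
    step i = emits λ acc →
      subst (λ x → Run (goRight (suc r)) (out acc ∷ B (suc (toℕ i)) [ r ]≔ word (toℕ i) g)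
                                         (out acc ∷ B (suc (toℕ i)) [ r ]≔ x))
        (cursor-right g [] i) (act₁-run (suc r) {xs = out acc ∷ B (suc (toℕ i))})

  scan-emits : ∀ r {f m xs} (g h : Fin m → Bool) → m ≤ S → lookup xs r ≡ word 0 g →
               (∀ i → f (blank ∷ scans (xs [ r ]≔ word (toℕ i) g)) ≡ h i) →
               Emits (foreach (suc r) (emit f)) xs (tabulate h) xs
  scan-emits r {f} {m} {xs} g h m≤S eq fh =
    subst₂ (λ ys u → Emits (foreach (suc r) (emit f)) ys u ys) (restore eq) (concat-tabulate-singleton h)
      (foreach-emits r g (const xs) (λ i → h i ∷ []) m≤S (λ i → emit-emits (fh i)))

  fill-emits : ∀ r b {m xs} (g : Fin m → Bool) → m ≤ S → lookup xs r ≡ word 0 g →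
               Emits (fill r b) xs (tabulate {n = m} (const b)) xs
  fill-emits r b g m≤S eq = scan-emits r g (const b) m≤S eq (λ _ → refl)

  copy-emits : ∀ r {m xs} (g : Fin m → Bool) → m ≤ S → lookup xs r ≡ word 0 g →
               Emits (copy r) xs (tabulate g) xs
  copy-emits r {xs = xs} g m≤S eq = scan-emits r g g m≤S eq
    (λ i → trans (cong isOne (trans (scans-update r xs _) (cursor-scan g [] i))) (isOne-bit (g i)))

-- The program for the reduction

-- The work tapes hold 1ⁿ (twice), a one-hot word of length n, 1ᴷ, the adjacency matrix,
-- and a one-hot word of length n².
pattern N = zero
pattern M = suc zero
pattern V = suc (suc zero)
pattern B = suc (suc (suc zero))
pattern A = suc (suc (suc (suc zero)))
pattern E = suc (suc (suc (suc (suc zero))))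

Program : Set
Program = Prog 7

append : Fin 6 → (Vec Sym 7 → Bool) → Program
append r f = act (suc r) (put ∘ f)

skip : Program
skip = goRight zero

read-order read-bound read-matrix parse header₁ header₂ pre-row exit-row hub-row zero-row
  pre-rows exit-rows hub-rows post-rows entry-rows body program : Program
read-order =
  while₁ zero isOne (append N (const true) ⨾ append M (const true) ⨾ append V (const false) ⨾ skip)
read-bound = while₁ zero isOne (append B (const true) ⨾ skip)
read-matrix =
  while₁ zero isBit (append A (λ ss → isOne (lookup ss zero)) ⨾ append E (const false) ⨾ skip)
parse =
  -- Every work tape leaves a blank behind, the left delimiter at which `rewind` stops.
  goRight (suc N) ⨾ goRight (suc M) ⨾ goRight (suc V) ⨾ goRight (suc B) ⨾ goRight (suc A) ⨾ goRight (suc E) ⨾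
  read-order ⨾ skip ⨾ read-bound ⨾ skip ⨾ read-matrix ⨾ skip ⨾
  rewind (suc N) ⨾ rewind (suc M) ⨾ rewind (suc V) ⨾ rewind (suc B) ⨾ rewind (suc A) ⨾ rewind (suc E)
header₁ = fill N true ⨾ fill A true ⨾ fill N true ⨾ fill N true ⨾ fill A true ⨾ emit (const false)
header₂ = fill N true ⨾ fill A true ⨾ fill B true ⨾ emit (const false)
pre-row  = fill V false ⨾ fill E false ⨾ copy V ⨾ fill V false ⨾ fill E false
-- The head of `A` rests on the bit of the current pair, so constant words of length n² are written
-- along `E` instead. In the hub columns the one-hot word of the head of the pair is masked by that
-- bit.
exit-row = fill V false ⨾ fill E false ⨾ foreach (suc V) (emit (λ ss → bitAt V ss ∧ bitAt A ss)) ⨾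
           fill V false ⨾ copy E
-- The entry columns are grouped by tail into `n` groups of size `n`, so every bit of the one-hot
-- word is written `n` times.
hub-row  = fill V false ⨾ fill E false ⨾ fill V false ⨾ copy V ⨾
           foreach (suc V) (foreach (suc M) (emit (bitAt V)))
zero-row = fill V false ⨾ fill E false ⨾ fill V false ⨾ fill V false ⨾ fill E false
pre-rows   = mark (suc V) ⨾ foreach (suc N) (pre-row ⨾ advance (suc V))
-- A loop occupies the head of its tape, so the nested loops over tail and head of a pair use
-- separate copies of 1ⁿ. The mark on `E` and the head of `A` follow the pair itself.
exit-rows  = mark (suc E) ⨾
  foreach (suc N)
    (mark (suc V) ⨾ foreach (suc M) (exit-row ⨾ advance (suc V) ⨾ advance (suc E) ⨾ goRight (suc A))) ⨾
  rewind (suc A)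
hub-rows   = mark (suc V) ⨾ foreach (suc N) (hub-row ⨾ advance (suc V))
post-rows  = foreach (suc N) zero-row
entry-rows = foreach (suc A) zero-row
body       = header₁ ⨾ header₂ ⨾ pre-rows ⨾ exit-rows ⨾ hub-rows ⨾ post-rows ⨾ entry-rows
program    = parse ⨾ body ⨾ rewind zero

ones : ℕ → List Bool
ones m = tabulate {n = m} (const true)

ones-unary : ∀ a b → ones a ++ unary b ≡ unary (a + b)
ones-unary zero    b = refl
ones-unary (suc a) b = cong (true ∷_) (ones-unary a b)

ones-false : ∀ a → ones a ++ false ∷ [] ≡ unary a
ones-false a = cong (_++ false ∷ []) (tabulate-const a true)

-- Correctness of the program on one instance

module Correctness (n : ℕ) (adj : Fin n → Fin n → Bool) (k : ℕ) (S : ℕ)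
                   (n≤S : n ≤ S) (n²≤S : n * n ≤ S) (k≤S : k ≤ S) (0<n : 0 < n) where
  open Reduction n adj
  open Runs {7} S
  open Single {7} S

  adjacency : Pair → Bool
  adjacency e = adj (tail e) (head e)

  one : ∀ {m} → Fin m → Bool
  one _ = true

  works : (N-pos M-pos V-pos V-mark A-pos E-mark : ℕ) → Vec Shape 6
  works N-pos M-pos V-pos V-mark A-pos E-mark =
    word {n} N-pos one ∷ word {n} M-pos one ∷ word V-pos (oneHot n V-mark) ∷
    word {k} 0 one ∷ word A-pos adjacency ∷ word 0 (oneHot (n * n) E-mark) ∷ []

  -- Marks at n and n * n lie beyond the ends of their words: all cells are false.
  idle-state : Vec Shape 6
  idle-state = works 0 0 0 n 0 (n * n)

  blocks : ∀ {X : Set} → (Node → X) → List X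
  blocks g = tabulate (g ∘ pre) ++ tabulate (g ∘ exit) ++ tabulate (g ∘ hub) ++ tabulate (g ∘ post) ++
             tabulate (g ∘ entry)

  row : Node → List Bool
  row x = blocks (arc x)

  rows : ∀ {m} → (Fin m → Node) → List Bool
  rows f = concat (tabulate (row ∘ f))

  module _ (base : List Sym) where
    open Emission {6} base S

    pre-row-emits : ∀ i v →
      Emits pre-row (works i 0 0 (toℕ v) 0 (n * n)) (row (pre v)) (works i 0 0 (toℕ v) 0 (n * n))
    pre-row-emits i v =
      fill-emits V false (oneHot n (toℕ v)) n≤S refl ▷
      fill-emits E false (oneHot (n * n) (n * n)) n²≤S refl ▷
      copy-emits V (oneHot n (toℕ v)) n≤S refl ▷
      fill-emits V false (oneHot n (toℕ v)) n≤S refl ▷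
      fill-emits E false (oneHot (n * n) (n * n)) n²≤S refl

    zero-row-emits : ∀ i j →
      Emits zero-row (works i 0 0 n j (n * n)) (blocks (const false)) (works i 0 0 n j (n * n))
    zero-row-emits i j =
      fill-emits V false (oneHot n n) n≤S refl ▷
      fill-emits E false (oneHot (n * n) (n * n)) n²≤S refl ▷
      fill-emits V false (oneHot n n) n≤S refl ▷
      fill-emits V false (oneHot n n) n≤S refl ▷
      fill-emits E false (oneHot (n * n) (n * n)) n²≤S refl

    exit-row-emits : ∀ i j u v → let e = combine u v in
      Emits exit-row (works i j 0 (toℕ v) (toℕ e) (toℕ e)) (row (exit e))
                     (works i j 0 (toℕ v) (toℕ e) (toℕ e))
    exit-row-emits i j u v =
      fill-emits V false (oneHot n (toℕ v)) n≤S refl ▷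
      fill-emits E false (oneHot (n * n) (toℕ e)) n²≤S refl ▷
      scan-emits V (oneHot n (toℕ v)) (λ w → arc (exit e) (hub w)) n≤S refl (λ w → cong₂ _∧_
        (trans (cong isOne (cursor-scan (oneHot n (toℕ v)) [] w))
               (trans (isOne-bit _) (cong (_== w) (sym (cong proj₂ (ends-pair (u , v)))))))
        (trans (cong isOne (cursor-scan adjacency [] e)) (isOne-bit _))) ▷
      fill-emits V false (oneHot n (toℕ v)) n≤S refl ▷
      copy-emits E (oneHot (n * n) (toℕ e)) n²≤S refl
      where
      e : Pair
      e = combine u v

    hub-row-emits : ∀ i v →
      Emits hub-row (works i 0 0 (toℕ v) 0 (n * n)) (row (hub v)) (works i 0 0 (toℕ v) 0 (n * n))
    hub-row-emits i v =
      fill-emits V false g n≤S refl ▷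
      fill-emits E false (oneHot (n * n) (n * n)) n²≤S refl ▷
      fill-emits V false g n≤S refl ▷
      copy-emits V g n≤S refl ▷
      subst (λ u → Emits (foreach (suc V) (foreach (suc M) (emit (bitAt V))))
                         (works i 0 0 (toℕ v) 0 (n * n)) u (works i 0 0 (toℕ v) 0 (n * n)))
        (sym (tabulate-remQuot n n (λ (u , _) → v == u)))
        (foreach-emits V g (const (works i 0 0 (toℕ v) 0 (n * n))) (λ u → tabulate (λ _ → v == u)) n≤S
          (λ u → scan-emits M {xs = works i 0 (toℕ u) (toℕ v) 0 (n * n)} (one {n}) (λ _ → v == u) n≤S refl
            (λ _ → trans (cong isOne (cursor-scan g [] u)) (isOne-bit _))))
      where
      g : Fin n → Bool
      g = oneHot n (toℕ v)

    mark-emits : ∀ r {xs m} → 0 < m → lookup xs r ≡ word 0 (oneHot m m) →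
                 Emits (mark (suc r)) xs [] (xs [ r ]≔ word 0 (oneHot m 0))
    mark-emits r 0<m eq = emits λ acc → mark-run (suc r) 0<m eq

    advance-emits : ∀ r {xs m} (i : Fin m) → m ≤ S → lookup xs r ≡ word 0 (oneHot m (toℕ i)) →
                    Emits (advance (suc r)) xs [] (xs [ r ]≔ word 0 (oneHot m (suc (toℕ i))))
    advance-emits r i m≤S eq = emits λ acc → advance-run (suc r) i m≤S eq

    header₁-emits : Emits header₁ idle-state (unary order) idle-state
    header₁-emits = subst (λ u → Emits header₁ idle-state u idle-state) eq
      (fill-emits N true (one {n}) n≤S refl ▷ fill-emits A true adjacency n²≤S refl ▷
       fill-emits N true (one {n}) n≤S refl ▷ fill-emits N true (one {n}) n≤S refl ▷
       fill-emits A true adjacency n²≤S refl ▷ emit-emits refl)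
      where
      eq : ones n ++ ones (n * n) ++ ones n ++ ones n ++ ones (n * n) ++ false ∷ [] ≡ unary order
      eq rewrite ones-false (n * n) | ones-unary n (n * n) | ones-unary n (n + n * n)
               | ones-unary (n * n) (n + (n + n * n)) = ones-unary n _

    header₂-emits : Emits header₂ idle-state (unary (n + (n * n + k))) idle-state
    header₂-emits = subst (λ u → Emits header₂ idle-state u idle-state) eq
      (fill-emits N true (one {n}) n≤S refl ▷ fill-emits A true adjacency n²≤S refl ▷
       fill-emits B true (one {k}) k≤S refl ▷ emit-emits refl)
      where
      eq : ones n ++ ones (n * n) ++ ones k ++ false ∷ [] ≡ unary (n + (n * n + k))
      eq rewrite ones-false k | ones-unary (n * n) k = ones-unary n _

    pre-rows-emits : Emits pre-rows idle-state (rows pre) idle-state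
    pre-rows-emits =
      mark-emits V 0<n refl ▷
      foreach-emits N one (λ v → works 0 0 0 v 0 (n * n)) (row ∘ pre) n≤S
        (λ v → pre-row-emits (toℕ v) v ▹ advance-emits V v n≤S refl)

    hub-rows-emits : Emits hub-rows idle-state (rows hub) idle-state
    hub-rows-emits =
      mark-emits V 0<n refl ▷
      foreach-emits N one (λ v → works 0 0 0 v 0 (n * n)) (row ∘ hub) n≤S
        (λ v → hub-row-emits (toℕ v) v ▹ advance-emits V v n≤S refl)

    post-rows-emits : Emits post-rows idle-state (rows post) idle-state
    post-rows-emits = foreach-emits N one (const idle-state) (row ∘ post) n≤S
      (λ v → zero-row-emits (toℕ v) 0)

    entry-rows-emits : Emits entry-rows idle-state (rows entry) idle-state
    entry-rows-emits = foreach-emits A adjacency (const idle-state) (row ∘ entry) n²≤S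
      (λ e → zero-row-emits 0 (toℕ e))

    -- Before line `u` the head of `A` and the mark on `E` are both at `n * u`, the index of the
    -- first pair with tail `u`. After the last line the mark has dropped off and `A` is rewound.
    exit-rows-emits : Emits exit-rows idle-state (rows exit) idle-state
    exit-rows-emits = subst (λ u → Emits exit-rows idle-state u idle-state)
      (sym (concat-tabulate-combine n n (row ∘ exit)))
      (mark-emits E (ℕ.*-mono-≤ 0<n 0<n) refl ▷
       subst (λ e → Emits (foreach (suc N) lines) (works 0 0 0 n e e)
                          (concat (tabulate line-word))
                          (works 0 0 0 n (n * n) (n * n))) (ℕ.*-zeroʳ n)
         (foreach-emits N one (λ u → works 0 0 0 n (n * u) (n * u)) line-word n≤S line)
       ▹ emits λ acc → rewind-word (suc A) (tabulate adjacency)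
           (subst (_≤ S) (sym (length-tabulate adjacency)) n²≤S) (cursor-end adjacency []))
      where
      line-word : Fin n → List Bool
      line-word u = concat (tabulate λ v → row (exit (combine {n} {n} u v)))
      step lines : Program
      step = exit-row ⨾ advance (suc V) ⨾ advance (suc E) ⨾ goRight (suc A)
      lines = mark (suc V) ⨾ foreach (suc M) step
      cell : ∀ i (u v : Fin n) → let p = n * toℕ u + toℕ v ; q = n * toℕ u + suc (toℕ v) in
             Emits step (works i (toℕ v) 0 (toℕ v) p p) (row (exit (combine u v)))
                        (works i (toℕ v) 0 (suc (toℕ v)) q q)
      cell i u v = subst₂
        (λ p q → Emits step (works i (toℕ v) 0 (toℕ v) p p) (row (exit e))
                            (works i (toℕ v) 0 (suc (toℕ v)) q q))
        (toℕ-combine u v)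
        (trans (cong suc (toℕ-combine u v)) (sym (ℕ.+-suc (n * toℕ u) (toℕ v))))
        (exit-row-emits i (toℕ v) u v ▹ advance-emits V v n≤S refl ▷ advance-emits E e n²≤S refl ▷
         emits λ acc → act (cong (λ x → out acc ∷ works i (toℕ v) 0 (suc (toℕ v)) 0 (suc (toℕ e)) [ A ]≔ x)
                                 (cursor-right adjacency [] e)))
        where
        e : Pair
        e = combine u v
      line : ∀ u → Emits lines
                         (works (toℕ u) 0 0 n (n * toℕ u) (n * toℕ u))
                         (line-word u)
                         (works (toℕ u) 0 0 n (n * suc (toℕ u)) (n * suc (toℕ u)))
      line u = mark-emits V 0<n refl ▷
        subst₂ (λ p q → Emits (foreach (suc M) step) (works (toℕ u) 0 0 0 p p) (line-word u)
                                         (works (toℕ u) 0 0 n q q))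
          (ℕ.+-identityʳ (n * toℕ u))
          (trans (ℕ.+-comm (n * toℕ u) n) (sym (ℕ.*-suc n (toℕ u))))
          (foreach-emits M one (λ v → works (toℕ u) 0 0 v (n * toℕ u + v) (n * toℕ u + v))
            (λ v → row (exit (combine u v))) n≤S (cell (toℕ u) u))

    body-emits : Emits body idle-state
      (unary order ++ unary (n + (n * n + k)) ++ rows pre ++ rows exit ++ rows hub ++ rows post ++ rows entry)
      idle-state
    body-emits = header₁-emits ▷ header₂-emits ▷ pre-rows-emits ▷ exit-rows-emits ▷ hub-rows-emits ▷
      post-rows-emits ▷ entry-rows-emits

  -- Reading the input and running the whole program

  input-word : List Bool
  input-word = unary n ++ unary k ++ tabulate adjacency

  scratch : (ns ms vs ks as es : List Bool) → Vec Shape 6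
  scratch ns ms vs ks as es =
    at [] ns [] ∷ at [] ms [] ∷ at [] vs [] ∷ at [] ks [] ∷ at [] as [] ∷ at [] es [] ∷ []

  read-order-run : ∀ m rest {ls ns ms vs ks as es} → m ≤ S →
    Run read-order (input ls (unary m ++ rest) ∷ scratch ns ms vs ks as es)
      (input (replicate m true ʳ++ ls) (false ∷ rest) ∷
       scratch (replicate m true ʳ++ ns) (replicate m true ʳ++ ms) (replicate m false ʳ++ vs) ks as es)
  read-order-run m rest {ls} {ns} {ms} {vs} {ks} {as} {es} m≤S = while m≤S (iterate m)
    where
    iterate : ∀ j {ls ns ms vs} → Iterate _ _ j
      (input ls (unary j ++ rest) ∷ scratch ns ms vs ks as es)
      (input (replicate j true ʳ++ ls) (false ∷ rest) ∷
       scratch (replicate j true ʳ++ ns) (replicate j true ʳ++ ms) (replicate j false ʳ++ vs) ks as es)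
    iterate zero    = done refl
    iterate (suc j) = once refl (act refl ⨾ act refl ⨾ act refl ⨾ act refl) (iterate j)

  read-bound-run : ∀ m rest {ls ns ms vs ks as es} → m ≤ S →
    Run read-bound (input ls (unary m ++ rest) ∷ scratch ns ms vs ks as es)
      (input (replicate m true ʳ++ ls) (false ∷ rest) ∷ scratch ns ms vs (replicate m true ʳ++ ks) as es)
  read-bound-run m rest {ls} {ns} {ms} {vs} {ks} {as} {es} m≤S = while m≤S (iterate m)
    where
    iterate : ∀ j {ls ks} → Iterate _ _ j
      (input ls (unary j ++ rest) ∷ scratch ns ms vs ks as es)
      (input (replicate j true ʳ++ ls) (false ∷ rest) ∷ scratch ns ms vs (replicate j true ʳ++ ks) as es)
    iterate zero    = done refl
    iterate (suc j) = once refl (act refl ⨾ act refl) (iterate j)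

  read-matrix-run : ∀ bs {ls ns ms vs ks as es} → length bs ≤ S →
    Run read-matrix (input ls bs ∷ scratch ns ms vs ks as es)
      (input (bs ʳ++ ls) [] ∷ scratch ns ms vs ks (bs ʳ++ as) (replicate (length bs) false ʳ++ es))
  read-matrix-run bs {ls} {ns} {ms} {vs} {ks} {as} {es} bs≤S = while bs≤S (iterate bs)
    where
    iterate : ∀ bs {ls as es} → Iterate _ _ (length bs)
      (input ls bs ∷ scratch ns ms vs ks as es)
      (input (bs ʳ++ ls) [] ∷ scratch ns ms vs ks (bs ʳ++ as) (replicate (length bs) false ʳ++ es))
    iterate []           = done refl
    iterate (true ∷ bs)  = once refl (act refl ⨾ act refl ⨾ act refl) (iterate bs)
    iterate (false ∷ bs) = once refl (act refl ⨾ act refl ⨾ act refl) (iterate bs)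

  initial-works :
    at [] [] (replicate n true) ∷ at [] [] (replicate n true) ∷ at [] [] (replicate n false) ∷
    at [] [] (replicate k true) ∷ at [] [] (tabulate adjacency) ∷
    at [] [] (replicate (length (tabulate adjacency)) false) ∷ [] ≡ works 0 0 0 n 0 (n * n)
  initial-works
    rewrite length-tabulate adjacency | sym (tabulate-const n true) | sym (tabulate-const k true)
          | sym (tabulate-const n false) | sym (tabulate-const (n * n) false)
          | sym (oneHot-end n) | sym (oneHot-end (n * n)) = refl

  start : Vec Shape 7
  start = input [] input-word ∷ Vec.replicate 6 (input [] [])

  consumed : List Sym
  consumed = map bit (tabulate adjacency ʳ++
               (false ∷ (replicate k true ʳ++ (false ∷ (replicate n true ʳ++ [])))))

  parse-run : Run parse start (at consumed [] [] ∷ idle-state)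
  parse-run = subst (λ xs → Run parse start (at consumed [] [] ∷ xs)) initial-works
    (act refl ⨾ act refl ⨾ act refl ⨾ act refl ⨾ act refl ⨾ act refl ⨾
     read-order-run n (unary k ++ tabulate adjacency) n≤S ⨾ act refl ⨾
     read-bound-run k (tabulate adjacency) k≤S ⨾ act refl ⨾
     read-matrix-run (tabulate adjacency) n²≤S′ ⨾ act refl ⨾
     rewind-word (suc N) (replicate n true) (replicate-≤ n true n≤S) refl ⨾
     rewind-word (suc M) (replicate n true) (replicate-≤ n true n≤S) refl ⨾
     rewind-word (suc V) (replicate n false) (replicate-≤ n false n≤S) refl ⨾
     rewind-word (suc B) (replicate k true) (replicate-≤ k true k≤S) refl ⨾
     rewind-word (suc A) (tabulate adjacency) n²≤S′ refl ⨾
     rewind-word (suc E) (replicate (length (tabulate adjacency)) false) (replicate-≤ _ false n²≤S′) refl)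
    where
    n²≤S′ : length (tabulate adjacency) ≤ S
    n²≤S′ = subst (_≤ S) (sym (length-tabulate adjacency)) n²≤S
    replicate-≤ : ∀ m (b : Bool) → m ≤ S → length (replicate m b) ≤ S
    replicate-≤ m b = subst (_≤ S) (sym (length-replicate m))

  output-word : List Bool
  output-word = unary order ++ unary (n + (n * n + k)) ++
                rows pre ++ rows exit ++ rows hub ++ rows post ++ rows entry

  program-run : length output-word ≤ S →
    Run program start (at consumed [] output-word ∷ idle-state)
  program-run len = parse-run ⨾ Emission.run (body-emits consumed) [] ⨾ rewind-word zero output-word len refl

-- The reduction

outputWord-delimited : ∀ b v → outputWord (concrete (at b [] v)) ≡ v
outputWord-delimited b []      = refl
outputWord-delimited b (c ∷ v) = cong (c ∷_) (leadingBits-cells v)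
  where
  leadingBits-cells : ∀ v → leadingBits (cells v) ≡ v
  leadingBits-cells []      = refl
  leadingBits-cells (c ∷ v) = cong (c ∷_) (leadingBits-cells v)

concrete-input : ∀ u → concrete (input [] u) ≡ inputTape u
concrete-input []      = refl
concrete-input (_ ∷ _) = refl

run⇒outputs : ∀ {w} (p : Prog (suc w)) S {u b v xs} →
              Runs.Run S p (input [] u ∷ Vec.replicate w (input [] [])) (at b [] v ∷ xs) →
              ∃[ t ] (t ≤ time S p × TuringMachine.Outputs_On_InTime_ (machine p) v u t)
run⇒outputs {w} p S {u} {b} {v} {xs} r with t , t≤ , e ← Runs.run⇒exits S r =
  t , t≤ , final ,
  subst (λ ts → config (inj₂ (init p)) ts ⇓[ t ] final)
    (cong₂ _∷_ (concrete-input u) (map-replicate concrete (input [] []) w)) (exits⇒halts p e) ,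
  outputWord-delimited b v
  where
  open TuringMachine (machine p) using (Config; config; _⇓[_]_)
  final : Config
  final = config (inj₁ tt) (concreteAll (at b [] v ∷ xs))

-- Polynomial running time and the final assembly

*-^-distrib : ∀ m o d → (m * o) ^ d ≡ m ^ d * o ^ d
*-^-distrib m o zero    = refl
*-^-distrib m o (suc d) =
  trans (cong (m * o *_) (*-^-distrib m o d)) (ℕ.[m*n]*[o*p]≡[m*o]*[n*p] m o (m ^ d) (o ^ d))

-- Stated for suc l because the length of an encoding is positive.
square-bound : ∀ l {a b} → a ≤ 3 * suc l → b ≤ suc l → codeLength a b ≤ 15 * suc l ^ 2
square-bound l {a} {b} a≤ b≤ = begin
  suc a + (suc b + a * a)
    ≤⟨ ℕ.+-mono-≤ (s≤s a≤) (ℕ.+-mono-≤ (s≤s b≤) (ℕ.*-mono-≤ a≤ a≤)) ⟩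
  suc (3 * suc l) + (suc (suc l) + 3 * suc l * (3 * suc l))
    ≤⟨ ℕ.m≤m+n _ (6 * (l * l) + 8 * l) ⟩
  suc (3 * suc l) + (suc (suc l) + 3 * suc l * (3 * suc l)) + (6 * (l * l) + 8 * l)
    ≡⟨ expand l ⟩
  15 * (suc l * (suc l * 1)) ∎
  where
  open ℕ.≤-Reasoning
  expand : ∀ l → suc (3 * suc l) + (suc (suc l) + 3 * suc l * (3 * suc l)) + (6 * (l * l) + 8 * l) ≡
                 15 * (suc l * (suc l * 1))
  expand = solve-∀

module _ (P Q : Problem) (f : Problem.Instance P → Problem.Instance Q) {w} (p : Prog (suc w))
         (S : Problem.Instance P → ℕ) (a b : ℕ)
         (S≢0 : ∀ x → NonZero (S x)) (S≤ : ∀ x → S x ≤ a * length (Problem.encode P x) ^ b)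
         (outputs : ∀ x → ∃[ t ] (t ≤ time (S x) p ×
                      TuringMachine.Outputs_On_InTime_ (machine p)
                        (Problem.encode Q (f x)) (Problem.encode P x) t)) where

  polynomial-time : PolyTimeComputable P Q f
  polynomial-time = let c , d , time≤ = time-polynomial p in machine p , c * a ^ d , b * d , λ x →
    let t , t≤ , out = outputs x
        l = length (Problem.encode P x)
    in t , out , (begin
      t                                      ≤⟨ t≤ ⟩
      time (S x) p                           ≤⟨ time≤ (S x) {{S≢0 x}} ⟩
      c * S x ^ d                            ≤⟨ ℕ.*-monoʳ-≤ c (ℕ.^-monoˡ-≤ d (S≤ x)) ⟩
      c * (a * l ^ b) ^ d                    ≡⟨ cong (c *_) (*-^-distrib a (l ^ b) d) ⟩
      c * (a ^ d * (l ^ b) ^ d)              ≡⟨ cong (λ q → c * (a ^ d * q)) (ℕ.^-*-assoc l b d) ⟩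
      c * (a ^ d * l ^ (b * d))              ≡⟨ ℕ.*-assoc c (a ^ d) (l ^ (b * d)) ⟨
      c * a ^ d * l ^ (b * d)                ≤⟨ ℕ.m≤m+n _ _ ⟩
      c * a ^ d * l ^ (b * d) + c * a ^ d    ∎)
    where open ℕ.≤-Reasoning

module _ (x : FASInstance) where
  open FASInstance x
  open FinDigraph graph renaming (order to n)
  open Reduction n adj

  node : Fin order → Node
  node = Inverse.to numbering

  gadgetGraph : FinDigraph
  gadgetGraph = record { order = order ; adj = λ i j → arc (node i) (node j) }

  gadgetGraph-acyclic : Acyclic (FinDigraph.digraph gadgetGraph)
  gadgetGraph-acyclic C =
    contradiction
      (ranked-⁺ (level ∘ node) (λ {i} {j} a → level-< (arc⇒⟶ (node i) (node j) a))
        (walk⇒⁺ (DirectedCycle.start C) (DirectedCycle.rest C) (DirectedCycle.are-arcs C)))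
      (ℕ.<-irrefl refl)

  K′ : ℕ
  K′ = n + (n * n + K)

  instance-of : AHPInstance
  instance-of = record
    { graph    = gadgetGraph
    ; acyclic  = gadgetGraph-acyclic
    ; K        = K′
    ; positive = ≤-trans positive (≤-trans (ℕ.m≤n+m K (n * n)) (ℕ.m≤n+m _ n))
    -- Here `K ≤ n` pays off: the hubs alone supply `n` nodes beyond the first n + n².
    ; bounded  = ℕ.+-monoʳ-≤ n (ℕ.+-monoʳ-≤ (n * n) (≤-trans bounded (ℕ.m≤m+n n (n + n * n))))
    }

  toGadget : ∀ {k} → AcyclicHPartition (FinDigraph.digraph gadgetGraph) k → AcyclicHPartition Gadget k
  toGadget = transport-partition node (Inverse.from numbering)
    (Inverse.strictlyInverseʳ numbering) (Inverse.strictlyInverseˡ numbering)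
    (λ {i} {j} → arc⇒⟶ (node i) (node j))
    (λ {p} {q} a → subst₂ (λ p q → T (arc p q))
      (sym (Inverse.strictlyInverseˡ numbering p)) (sym (Inverse.strictlyInverseˡ numbering q)) (⟶⇒arc a))

  fromGadget : ∀ {k} → AcyclicHPartition Gadget k → AcyclicHPartition (FinDigraph.digraph gadgetGraph) k
  fromGadget = transport-partition (Inverse.from numbering) node
    (Inverse.strictlyInverseˡ numbering) (Inverse.strictlyInverseʳ numbering)
    (λ {p} {q} a → subst₂ (λ p q → T (arc p q))
      (sym (Inverse.strictlyInverseˡ numbering p)) (sym (Inverse.strictlyInverseˡ numbering q)) (⟶⇒arc a))
    (λ {i} {j} → arc⇒⟶ (node i) (node j))

  yes⇔yes : Problem.Yes FAS x ⇔ Problem.Yes AHP instance-of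
  yes⇔yes = mk⇔
    (λ (F , F≤K) → _ , ℕ.+-monoʳ-≤ n (ℕ.+-monoʳ-≤ (n * n) F≤K) ,
                   fromGadget (FromFAS.acyclicHPartition F))
    (λ (k , k≤K′ , p) → let π , ok = toGadget p in
       FromPartition.feedbackArcSet π ok ,
       ℕ.+-cancelˡ-≤ (n * n) _ _ (ℕ.+-cancelˡ-≤ n _ _ (≤-trans (FromPartition.size-bound π ok) k≤K′)))

  -- Bounds every loop: the words on the work tapes have lengths `n`, n² and `K`, all at most
  -- `order`, and the last rewind crosses the whole output.
  outputLength : ℕ
  outputLength = codeLength order K′

  n≤order : n ≤ order
  n≤order = ℕ.m≤m+n n _

  order≤outputLength : order ≤ outputLength
  order≤outputLength = ≤-trans (ℕ.n≤1+n order) (ℕ.m≤m+n (suc order) _)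

  n²≤order : n * n ≤ order
  n²≤order = ≤-trans (ℕ.m≤m+n (n * n) _) (ℕ.m≤n+m _ n)

  open Correctness n adj K outputLength
    (≤-trans n≤order order≤outputLength) (≤-trans n²≤order order≤outputLength)
    (≤-trans bounded (≤-trans n≤order order≤outputLength)) (≤-trans positive bounded)

  -- `numbering` decodes an index by successive `splitAt`s, each of which cuts one block off the
  -- enumeration.
  tabulate-node : ∀ {X : Set} (g : Node → X) → tabulate (g ∘ node) ≡ blocks g
  tabulate-node g =
    trans (tabulate-splitAt n (g ∘ fromKind ∘ Sum.map id split₂)) (cong (tabulate (g ∘ pre) ++_)
    (trans (tabulate-splitAt (n * n) (g ∘ fromKind ∘ inj₂ ∘ Sum.map id split₃))
           (cong (tabulate (g ∘ exit) ++_)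
    (trans (tabulate-splitAt n (g ∘ fromKind ∘ inj₂ ∘ inj₂ ∘ Sum.map id (splitAt n)))
           (cong (tabulate (g ∘ hub) ++_)
    (tabulate-splitAt n (g ∘ fromKind ∘ inj₂ ∘ inj₂ ∘ inj₂)))))))
    where
    split₃ : Fin (n + (n + n * n)) → Fin n ⊎ (Fin n ⊎ Pair)
    split₃ = Sum.map id (splitAt n) ∘ splitAt n
    split₂ : Fin (n * n + (n + (n + n * n))) → Pair ⊎ (Fin n ⊎ (Fin n ⊎ Pair))
    split₂ = Sum.map id split₃ ∘ splitAt (n * n)

  concat-blocks : ∀ (g : Node → List Bool) → concat (blocks g) ≡
    concat (tabulate (g ∘ pre)) ++ concat (tabulate (g ∘ exit)) ++ concat (tabulate (g ∘ hub)) ++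
    concat (tabulate (g ∘ post)) ++ concat (tabulate (g ∘ entry))
  concat-blocks g =
    trans (sym (concat-++ (tabulate (g ∘ pre)) _)) (cong (concat (tabulate (g ∘ pre)) ++_)
    (trans (sym (concat-++ (tabulate (g ∘ exit)) _)) (cong (concat (tabulate (g ∘ exit)) ++_)
    (trans (sym (concat-++ (tabulate (g ∘ hub)) _)) (cong (concat (tabulate (g ∘ hub)) ++_)
    (sym (concat-++ (tabulate (g ∘ post)) _)))))))

  output-word-encodes : output-word ≡ Problem.encode AHP instance-of
  output-word-encodes = cong (λ u → unary order ++ unary K′ ++ u) (sym (begin
    concat (tabulate λ i → tabulate λ j → arc (node i) (node j))
      ≡⟨ cong concat (tabulate-cong λ i → tabulate-node (arc (node i))) ⟩
    concat (tabulate (row ∘ node))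
      ≡⟨ cong concat (tabulate-node row) ⟩
    concat (blocks row)
      ≡⟨ concat-blocks row ⟩
    rows pre ++ rows exit ++ rows hub ++ rows post ++ rows entry ∎))
    where open ≡-Reasoning

  input-word-encodes : input-word ≡ Problem.encode FAS x
  input-word-encodes = cong (λ u → unary n ++ unary K ++ u) (tabulate-remQuot n n (uncurry adj))

  length-output-word : length output-word ≡ outputLength
  length-output-word = trans (cong length output-word-encodes) (length-encode gadgetGraph K′)

  outputs : ∃[ t ] (t ≤ time outputLength program ×
                    TuringMachine.Outputs_On_InTime_ (machine program)
                      (Problem.encode AHP instance-of) (Problem.encode FAS x) t)
  outputs = subst₂
    (λ u v → ∃[ t ] (t ≤ time outputLength program ×
                     TuringMachine.Outputs_On_InTime_ (machine program) v u t))
    input-word-encodes output-word-encodes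
    (run⇒outputs program outputLength (program-run (≤-reflexive length-output-word)))

  -- With L the input length, the gadget has 3n + 2n² ≤ 3L nodes and its bound `K′` is at most L.
  -- The output length is thus at most 9L² + 4L + 2, and 15 is the sum of these coefficients.
  outputLength-≤ : outputLength ≤ 15 * length (Problem.encode FAS x) ^ 2
  outputLength-≤ = subst (λ l → outputLength ≤ 15 * l ^ 2) (sym (length-encode graph K))
    (square-bound (n + (suc K + n * n))
      (≤-trans (ℕ.m≤m+n order _) (≤-reflexive (order-slack n K)))
      (≤-trans (ℕ.m≤m+n K′ 2) (≤-reflexive (bound-slack n K))))
    where
    order-slack : ∀ n K → n + (n * n + (n + (n + n * n))) + (6 + 3 * K + n * n) ≡
                          3 * suc (n + (suc K + n * n))
    order-slack = solve-∀
    bound-slack : ∀ n K → n + (n * n + K) + 2 ≡ suc (n + (suc K + n * n))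
    bound-slack = solve-∀

reduction-polynomial : PolyTimeComputable FAS AHP instance-of
reduction-polynomial =
  polynomial-time FAS AHP instance-of program outputLength 15 2 (λ _ → _) outputLength-≤ outputs

theorem5p10 : FAS ReducesTo AHP
theorem5p10 = instance-of , reduction-polynomial , yes⇔yes
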